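{- For positive integers $k_1,\dots,k_l$ with $k_1\ge2$, \[ \begin{aligned} &\sum_{i=1}^l\sum_{j=0}^{k_i-2}\zeta_q^t(k_1,\dots,k_{i-1},k_i-j,j+1,k_{i+1},\dots,k_l)\\ &=\sum_{i=1}^l\{1+(k_i-2+\delta_{i,l})t\}\,\zeta_q^t(k_1,\dots,k_{i-1},k_i+1,k_{i+1},\dots,k_l) +t(t-1)\sum_{i=1}^{l-1}\zeta_q^t(k_1,\dots,k_{i-1},k_i+k_{i+1}+1,k_{i+2},\dots,k_l)\\ &\quad+(1-q)\Bigl\{\sum_{i=1}^l t(k_i-1)\,\zeta_q^t(k_1,\dots,k_l)+t(t-1)\sum_{i=1}^{l-1}\zeta_q^t(k_1,\dots,k_{i-1},k_i+k_{i+1},k_{i+2},\dots,k_l)\Bigr\}, \end{aligned} \] where $\delta_{i,l}$ is the Kronecker delta.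
   Context: Let $q$, $t$ be formal parameters and $[n]=\frac{1-q^n}{1-q}$. For positive integers $k_1,\dots,k_l$ with $k_1\ge 2$ put $\zeta_q(k_1,\dots,k_l)=\sum_{m_1>m_2>\cdots>m_l\ge1}\prod_{a=1}^l \frac{q^{(k_a-1)m_a}}{[m_a]^{k_a}}\in\mathbb{Q}[[q]]$. The weight of an index is the sum of its entries and its depth is the number of entries. Define $\zeta_q^t(k_1,\dots,k_l)=\sum'_{\mathbf p}(1-q)^{k-\mathrm{wt}(\mathbf p)}\zeta_q(\mathbf p)\,t^{l-\mathrm{dep}(\mathbf p)}\in\mathbb{Q}[[q]][t]$, where $k=k_1+\cdots+k_l$ and $\mathbf p$ runs over all indices of the form $(k_1\ \square\ k_2\ \square\cdots\square\ k_l)$ with each $\square$ filled by "," (comma), "$+$" or "$-1+$". An inner sum $\sum_{j=0}^{k_i-2}$ is empty when $k_i=1$. -}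

module Defs where

open import Algebra.Bundles.Raw using (RawRing)
import Algebra.Definitions.RawSemiring as RawSemiringDefs
import Algebra.Properties.Monoid.Sum as MonoidSum
open import Data.Bool.Base using (if_then_else_)
open import Data.Fin.Base using (Fin; zero; suc; toℕ)
open import Data.Fin.Properties using (toℕ≤pred[n])
open import Data.List.Base as List using (List; []; _∷_; length; map; _++_)
open import Data.Nat.Base as ℕ using (ℕ; zero; suc; _∸_; _≤_; z≤n; s≤s)
import Data.Nat.Properties as ℕ
open import Data.Rational.Base as ℚ using (ℚ; 0ℚ; 1ℚ)
import Data.Rational.Properties as ℚ
open import Data.Vec.Base as Vec using (Vec)
open import Data.Vec.Functional using (Vector)
open import Level using (0ℓ)
open import Relation.Binary.PropositionalEquality
  using (_≡_; refl; sym; trans; cong; cong₂; module ≡-Reasoning)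
open import Relation.Nullary.Decidable.Core using (does)

module RingNotation {c ℓ} (R : RawRing c ℓ) where
  open RawRing R
  open RawSemiringDefs rawSemiring public using (sum; _^_; _×_)

  infixl 6 _-_
  _-_ : Carrier → Carrier → Carrier
  x - y = x + - y

  -- The scope of ∑ extends as far to the right as possible.
  infixr 5 ∑-syntax
  ∑-syntax : ∀ n → Vector Carrier n → Carrier
  ∑-syntax _ = sum

  syntax ∑-syntax n (λ i → x) = ∑[ i < n ] x

  sumList : List Carrier → Carrier
  sumList = List.foldr _+_ 0#

-- The ring R⟦X⟧; a series is its sequence of coefficients.
module PowerSeries {c ℓ} (R : RawRing c ℓ) where
  private
    module R where
      open RawRing R public
      open RingNotation R public
  open RingNotation R using (∑-syntax)

  Series : Set c
  Series = ℕ → R.Carrier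

  rawRing : RawRing c ℓ
  rawRing = record
    { Carrier = Series
    ; _≈_     = λ f g → ∀ n → f n R.≈ g n
    ; _+_     = λ f g n → f n R.+ g n
    ; _*_     = λ f g n → ∑[ i < suc n ] f (toℕ i) R.* g (n ∸ toℕ i)
    ; -_      = λ f n → R.- f n
    ; 0#      = λ _ → R.0#
    ; 1#      = λ { zero → R.1# ; (suc _) → R.0# }
    }

  X : Series
  X zero          = R.0#
  X (suc zero)    = R.1#
  X (suc (suc _)) = R.0#

  -- The coefficients of 1/f in degrees n, n-1, …, 0.  Only meaningful when f
  -- has constant coefficient 1, which is the case wherever `inv` is used below.
  invCoeffs : Series → ∀ n → Vec R.Carrier (suc n)
  invCoeffs f zero    = R.1# Vec.∷ Vec.[]
  invCoeffs f (suc n) =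
    (R.- (∑[ i < suc n ] f (suc (toℕ i)) R.* Vec.lookup gs i)) Vec.∷ gs
    where gs = invCoeffs f n

  inv : Series → Series
  inv f n = Vec.head (invCoeffs f n)

  infixl 7 _/_
  _/_ : Series → Series → Series
  f / g = RawRing._*_ rawRing f (inv g)

-- The ring R[X]; a polynomial is a list of coefficients, constant term first,
-- with trailing zeros allowed (and ignored by the equality).
module Polynomial {c ℓ} (R : RawRing c ℓ) where
  private module R = RawRing R

  Poly : Set c
  Poly = List R.Carrier

  coeff : Poly → ℕ → R.Carrier
  coeff []       _       = R.0#
  coeff (a ∷ _)  zero    = a
  coeff (_ ∷ as) (suc n) = coeff as n

  add : Poly → Poly → Poly
  add []       bs       = bs
  add (a ∷ as) []       = a ∷ as
  add (a ∷ as) (b ∷ bs) = (a R.+ b) ∷ add as bs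

  mul : Poly → Poly → Poly
  mul []       _  = []
  mul (a ∷ as) bs = add (map (a R.*_) bs) (R.0# ∷ mul as bs)

  rawRing : RawRing c ℓ
  rawRing = record
    { Carrier = Poly
    ; _≈_     = λ f g → ∀ n → coeff f n R.≈ coeff g n
    ; _+_     = add
    ; _*_     = mul
    ; -_      = map R.-_
    ; 0#      = []
    ; 1#      = R.1# ∷ []
    }

  C : R.Carrier → Poly
  C a = a ∷ []

  X : Poly
  X = R.0# ∷ R.1# ∷ []

ℚ⟦q⟧ : RawRing 0ℓ 0ℓ
ℚ⟦q⟧ = PowerSeries.rawRing ℚ.+-*-rawRing

ℚ⟦q⟧[t] : RawRing 0ℓ 0ℓ
ℚ⟦q⟧[t] = Polynomial.rawRing ℚ⟦q⟧

module _ where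
  open RawRing ℚ⟦q⟧
  open RingNotation ℚ⟦q⟧
  open PowerSeries ℚ.+-*-rawRing using (inv; _/_)

  q : Carrier
  q = PowerSeries.X ℚ.+-*-rawRing

  1-q : Carrier
  1-q = 1# - q

  [_] : ℕ → Carrier
  [ n ] = (1# - q ^ n) / (1# - q)

  -- The sum over M ≥ m₁ > m₂ > ⋯ > m_l ≥ 1 of ∏ₐ q^((kₐ-1)mₐ) / [mₐ]^kₐ; the
  -- index i stands for m₁ - 1, which bounds m₂.
  ζq≤ : ℕ → List ℕ → Carrier
  ζq≤ M []       = 1#
  ζq≤ M (k ∷ ks) =
    ∑[ i < M ] q ^ ((k ∸ 1) ℕ.* suc (toℕ i)) / [ suc (toℕ i) ] ^ k * ζq≤ (toℕ i) ks

  -- The infinite sum, for k₁ ≥ 2: a term is divisible by q^m₁, so those with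
  -- m₁ > n do not contribute to the coefficient of qⁿ (see `ζq-limit`).
  ζq : List ℕ → Carrier
  ζq ks n = ζq≤ n ks n

  private
    module Σℚ = MonoidSum ℚ.+-0-monoid

    sum-zero : ∀ {n} {f : Vector ℚ n} → (∀ i → f i ≡ 0ℚ) → Σℚ.sum f ≡ 0ℚ
    sum-zero {n} f≡0 = trans (Σℚ.sum-cong-≗ f≡0) (Σℚ.sum-replicate-zero n)

    lookup-inv : ∀ f n (i : Fin (suc n)) →
                 Vec.lookup (PowerSeries.invCoeffs ℚ.+-*-rawRing f n) i ≡ inv f (n ∸ toℕ i)
    lookup-inv f zero    zero    = refl
    lookup-inv f (suc n) zero    = refl
    lookup-inv f (suc n) (suc i) = lookup-inv f n i

  *-inv : ∀ f → f 0 ≡ 1ℚ → f * inv f ≈ 1#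
  *-inv f f0 zero rewrite f0 = refl
  *-inv f f0 (suc n) = begin
    f 0 ℚ.* (ℚ.- S) ℚ.+ S′ ≡⟨ cong₂ ℚ._+_ -S≡ (sym S≡S′) ⟩
    ℚ.- S ℚ.+ S            ≡⟨ ℚ.+-inverseˡ S ⟩
    0ℚ                     ∎
    where
    open ≡-Reasoning
    S S′ : ℚ
    S  = Σℚ.sum {suc n} λ i →
           f (suc (toℕ i)) ℚ.* Vec.lookup (PowerSeries.invCoeffs ℚ.+-*-rawRing f n) i
    S′ = Σℚ.sum {suc n} λ i → f (suc (toℕ i)) ℚ.* inv f (n ∸ toℕ i)
    -S≡ : f 0 ℚ.* (ℚ.- S) ≡ ℚ.- S
    -S≡ = trans (cong (ℚ._* (ℚ.- S)) f0) (ℚ.*-identityˡ (ℚ.- S))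
    S≡S′ : S ≡ S′
    S≡S′ = Σℚ.sum-cong-≗ λ i → cong (f (suc (toℕ i)) ℚ.*_) (lookup-inv f n i)

  1-q-constant : 1-q 0 ≡ 1ℚ
  1-q-constant = refl

  []-constant : ∀ m → [ suc m ] 0 ≡ 1ℚ
  []-constant m rewrite ℚ.*-zeroˡ ((q ^ m) 0) = refl

  ^-constant : ∀ f k → f 0 ≡ 1ℚ → (f ^ k) 0 ≡ 1ℚ
  ^-constant f zero    f0 = refl
  ^-constant f (suc k) f0 rewrite f0 | ^-constant f k f0 = refl

  private
    *-order : ∀ f g {d} → (∀ n → n ℕ.< d → f n ≡ 0ℚ) → ∀ n → n ℕ.< d → (f * g) n ≡ 0ℚ
    *-order f g f≡0 n n<d = sum-zero {suc n} λ i →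
      trans (cong (ℚ._* g (n ∸ toℕ i)) (f≡0 (toℕ i) (ℕ.≤-<-trans (toℕ≤pred[n] i) n<d)))
            (ℚ.*-zeroˡ (g (n ∸ toℕ i)))

    q^-order : ∀ d n → n ℕ.< d → (q ^ d) n ≡ 0ℚ
    q^-order (suc d) zero    _         =
      cong (ℚ._+ 0ℚ) (ℚ.*-zeroˡ ((q ^ d) 0))
    q^-order (suc d) (suc n) (s≤s n<d) = sum-zero {suc (suc n)} {λ i → q (toℕ i) ℚ.* g i} λ
      { zero             → ℚ.*-zeroˡ (g zero)
      ; (suc zero)       → trans (ℚ.*-identityˡ (g (suc zero))) (q^-order d n n<d)
      ; i@(suc (suc _))  → ℚ.*-zeroˡ (g i) }
      where
      g : Fin (suc (suc n)) → ℚ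
      g i = (q ^ d) (suc n ∸ toℕ i)

    -- Sums of series are computed coefficientwise.
    sum-coeff : ∀ {N} (F : Vector Carrier N) n → sum F n ≡ Σℚ.sum (λ i → F i n)
    sum-coeff {zero}  F n = refl
    sum-coeff {suc N} F n = cong (F zero n ℚ.+_) (sum-coeff (λ i → F (suc i)) n)

    sum-extend : ∀ n M (f : ℕ → ℚ) → n ≤ M → (∀ m → n ≤ m → f m ≡ 0ℚ) →
                 Σℚ.sum {M} (λ i → f (toℕ i)) ≡ Σℚ.sum {n} (λ i → f (toℕ i))
    sum-extend zero    M       f _         f≡0 = sum-zero {M} λ i → f≡0 (toℕ i) z≤n
    sum-extend (suc n) (suc M) f (s≤s n≤M) f≡0 =
      cong (f 0 ℚ.+_) (sum-extend n M (λ m → f (suc m)) n≤M (λ m n≤m → f≡0 (suc m) (s≤s n≤m)))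

  ζq-limit : ∀ k ks n M → 2 ≤ k → n ≤ M → ζq≤ M (k ∷ ks) n ≡ ζq (k ∷ ks) n
  ζq-limit k@(suc (suc k-2)) ks n M (s≤s (s≤s _)) n≤M = begin
    ζq≤ M (k ∷ ks) n                    ≡⟨ sum-coeff {M} (λ i → term (toℕ i)) n ⟩
    Σℚ.sum {M} (λ i → term (toℕ i) n)   ≡⟨ sum-extend n M (λ m → term m n) n≤M small ⟩
    Σℚ.sum {n} (λ i → term (toℕ i) n)   ≡⟨ sum-coeff {n} (λ i → term (toℕ i)) n ⟨
    ζq (k ∷ ks) n                       ∎
    where
    open ≡-Reasoning
    term : ℕ → Carrier
    term m = q ^ ((k ∸ 1) ℕ.* suc m) / [ suc m ] ^ k * ζq≤ m ks
    small : ∀ m → n ≤ m → term m n ≡ 0ℚ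
    small m n≤m =
      *-order (q ^ ((k ∸ 1) ℕ.* suc m) / [ suc m ] ^ k) (ζq≤ m ks)
        (*-order (q ^ ((k ∸ 1) ℕ.* suc m)) (inv ([ suc m ] ^ k))
          (q^-order ((k ∸ 1) ℕ.* suc m))) n
        (ℕ.≤-trans (s≤s n≤m) (ℕ.m≤m+n (suc m) (k-2 ℕ.* suc m)))

wt dep : List ℕ → ℕ
wt  = List.sum
dep = length

-- All indices (k □ k₂ □ ⋯ □ k_l), for ks = k₂, …, k_l, one for each of the 3^(l-1)
-- ways of filling the boxes with ",", "+" and "-1+"; an index arising from several
-- fillings is listed that many times.  The subtraction is exact as the entries
-- are positive.
fillings : ℕ → List ℕ → List (List ℕ)
fillings k []        = (k ∷ []) ∷ []
fillings k (k′ ∷ ks) =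
  map (k ∷_) (fillings k′ ks) ++ fillings (k ℕ.+ k′) ks ++ fillings (k ℕ.+ k′ ∸ 1) ks

open RawRing ℚ⟦q⟧[t] public using (_≈_; _+_; _*_; -_; 0#; 1#)
open RingNotation ℚ⟦q⟧[t] public
open Polynomial ℚ⟦q⟧ public using (C)

t : RawRing.Carrier ℚ⟦q⟧[t]
t = Polynomial.X ℚ⟦q⟧

-- The exponents are never truncated: wt 𝐩 ≤ wt 𝐤 and dep 𝐩 ≤ dep 𝐤.
ζqᵗ : List ℕ → RawRing.Carrier ℚ⟦q⟧[t]
ζqᵗ []         = 1#
ζqᵗ 𝐤@(k ∷ ks) = sumList (map
  (λ 𝐩 → C 1-q ^ (wt 𝐤 ∸ wt 𝐩) * C (ζq 𝐩) * t ^ (dep 𝐤 ∸ dep 𝐩))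
  (fillings k ks))

δ : ℕ → ℕ → ℕ
δ i j = if does (i ℕ.≟ j) then 1 else 0

{-# OPTIONS --safe #-}
module Submission where

-- Let S denote summation over the weighted fillings, and let D split, D raise, D rhs be the
-- operators "split an entry", "raise an entry by one" and "form the right-hand side", acting
-- on functions of indices.  For every such function
--   D split ∘ S - S ∘ D split = D rhs ∘ S - S ∘ D raise,
-- so the relation for ζqᵗ = S ζq follows from its case t = 0, D split ζq = D raise ζq.
--
-- For t = 0, partial fractions in 1/[m-n] turn the split sum over chains m₁ > ⋯ > m_l, cut
-- off at m₁ ≤ M, into a telescoping sum of the partial sums of q^m/[m].  What is left besides
-- the raised sums is an error term divisible by q^(M+1), so at M = n it does not affect the
-- coefficient of qⁿ.

open import Algebra.Bundles using (CommutativeRing; RawRing)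
open import Algebra.Morphism.Structures using (IsRingMonomorphism)
import Algebra.Morphism.RingMonomorphism as RingMonomorphism
import Algebra.Properties.AbelianGroup as AbelianGroupProperties
import Algebra.Properties.CommutativeSemiring.Exp as Exp
import Algebra.Properties.Group as GroupProperties
import Algebra.Properties.Ring as RingProperties
import Algebra.Properties.Semiring.Mult as Mult
import Algebra.Properties.Semiring.Mult.TCOptimised as MultTCOptimised
import Algebra.Properties.Semiring.Sum as SemiringSum
import Algebra.Solver.Ring as RingSolver
open import Algebra.Solver.Ring.AlmostCommutativeRing
  using (fromCommutativeRing; _-Raw-AlmostCommutative⟶_)
open import Data.Fin.Base using (suc; toℕ; inject₁)
import Data.Fin.Properties as Fin
open import Data.Integer.Base as ℤ using (ℤ; +_; -[1+_]; _⊖_)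
import Data.Integer.Properties as ℤ
open import Data.List.Base using (List; []; _∷_; _++_; length; lookup; map; take; drop)
import Data.List.Properties as List
open import Data.List.Relation.Unary.All as All using (All; []; _∷_)
open import Data.Maybe.Base using (Maybe; just; nothing)
open import Data.Nat.Base as ℕ using (ℕ; zero; suc; _≤_; _<_; _∸_; z≤n; s≤s)
import Data.Nat.Properties as ℕ
open import Data.Product.Base using (_,_)
import Data.Rational.Base as ℚ
import Data.Rational.Properties as ℚ
import Data.Sign.Base as Sign
open import Data.Sum.Base using (inj₁; inj₂)
open import Level using (0ℓ; _⊔_)
open import Relation.Binary.PropositionalEquality as ≡ using (_≡_)
import Relation.Binary.Reasoning.Setoid as SetoidReasoning
open import Relation.Nullary.Decidable.Core using (yes; no)
open import Defs
  using (module RingNotation; module PowerSeries; module Polynomial; fillings; wt; dep; δ)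

-- The commutator identity is proved for arbitrary functions because its induction on the tail
-- replaces `F` by `F` behind a fixed first entry, and ζq behind a prefix is no longer a ζq. The
-- q-integers enter through two facts. From [n+d] = q^d [n] + [d] come the partial fractions, which
-- produce differences 1/[d] - 1/[n+d]. Since 1/[m] = q^m/[m] + (1-q), with an offset independent of
-- m, these are also differences of q^m/[m], whose sums converge q-adically while those of 1/[m] do
-- not. The obstacle at t = 0 is the inner positions: entries behind the first may be 1, and there
-- the error need not be small. So the induction carries the exact error `E` at every level. For a
-- tail below a chain entry, the product of the harmonic sum `h` with the tail sum `Z` exceeds its
-- convolution by the same `E`, and the two cancel. Only the outermost error survives, where k₁ ≥ 2
-- makes it small.

module IntegerSolver {c ℓ} (R : CommutativeRing c ℓ) where
  open CommutativeRing R
  open MultTCOptimised semiring using (_×_; 1+×; ×-homo-+; ×1-homo-*)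
  open RingProperties ring using (-0#≈0#; -‿distribˡ-*; -‿distribʳ-*; -‿involutive)
  open AbelianGroupProperties +-abelianGroup using (⁻¹-∙-comm)
  open SetoidReasoning setoid

  -- The solver must compare coefficients, and equality of series has no decision procedure, so the
  -- coefficients are integers. The optimised multiples make `con (+ 1)` denote `1#` itself rather
  -- than `1# + 0#`.
  ⟦_⟧ℤ : ℤ → Carrier
  ⟦ + n ⟧ℤ      = n × 1#
  ⟦ -[1+ n ] ⟧ℤ = - (suc n × 1#)

  private
    ⊖-homo : ∀ m n → ⟦ m ⊖ n ⟧ℤ ≈ m × 1# + - (n × 1#)
    ⊖-homo m zero = begin
      m × 1#            ≈⟨ +-identityʳ _ ⟨
      m × 1# + 0#       ≈⟨ +-congˡ -0#≈0# ⟨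
      m × 1# + - 0#     ∎
    ⊖-homo zero (suc n) = sym (+-identityˡ _)
    ⊖-homo (suc m) (suc n) = begin
      ⟦ suc m ⊖ suc n ⟧ℤ                  ≡⟨ ≡.cong ⟦_⟧ℤ (ℤ.[1+m]⊖[1+n]≡m⊖n m n) ⟩
      ⟦ m ⊖ n ⟧ℤ                          ≈⟨ ⊖-homo m n ⟩
      m × 1# + - (n × 1#)                 ≈⟨ +-congʳ (+-identityʳ _) ⟨
      m × 1# + 0# + - (n × 1#)            ≈⟨ +-congʳ (+-congˡ (-‿inverseʳ 1#)) ⟨
      m × 1# + (1# + - 1#) + - (n × 1#)   ≈⟨ +-congʳ (+-assoc _ _ _) ⟨
      m × 1# + 1# + - 1# + - (n × 1#)     ≈⟨ +-assoc _ _ _ ⟩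
      m × 1# + 1# + (- 1# + - (n × 1#))   ≈⟨ +-cong (+-comm _ _) (⁻¹-∙-comm _ _) ⟩
      1# + m × 1# + - (1# + n × 1#)       ≈⟨ +-cong (1+× m 1#) (-‿cong (1+× n 1#)) ⟨
      suc m × 1# + - (suc n × 1#)         ∎

    +-homo : ∀ i j → ⟦ i ℤ.+ j ⟧ℤ ≈ ⟦ i ⟧ℤ + ⟦ j ⟧ℤ
    +-homo (+ m)      (+ n)      = ×-homo-+ 1# m n
    +-homo (+ m)      (-[1+ n ]) = ⊖-homo m (suc n)
    +-homo (-[1+ m ]) (+ n)      = trans (⊖-homo n (suc m)) (+-comm _ _)
    +-homo (-[1+ m ]) (-[1+ n ]) = begin
      - (suc (suc (m ℕ.+ n)) × 1#)        ≡⟨ ≡.cong (λ k → - (suc k × 1#)) (ℕ.+-suc m n) ⟨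
      - ((suc m ℕ.+ suc n) × 1#)          ≈⟨ -‿cong (×-homo-+ 1# (suc m) (suc n)) ⟩
      - (suc m × 1# + suc n × 1#)         ≈⟨ ⁻¹-∙-comm _ _ ⟨
      - (suc m × 1#) + - (suc n × 1#)     ∎

    -‿homo : ∀ i → ⟦ ℤ.- i ⟧ℤ ≈ - ⟦ i ⟧ℤ
    -‿homo (+ zero)   = sym -0#≈0#
    -‿homo (+ suc n)  = refl
    -‿homo (-[1+ n ]) = sym (-‿involutive _)

    *-homo : ∀ i j → ⟦ i ℤ.* j ⟧ℤ ≈ ⟦ i ⟧ℤ * ⟦ j ⟧ℤ
    *-homo (+ m) (+ n) = begin
      ⟦ Sign.+ ℤ.◃ (m ℕ.* n) ⟧ℤ  ≡⟨ ≡.cong ⟦_⟧ℤ (ℤ.+◃n≡+n (m ℕ.* n)) ⟩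
      (m ℕ.* n) × 1#             ≈⟨ ×1-homo-* m n ⟩
      (m × 1#) * (n × 1#)        ∎
    *-homo (+ m) (-[1+ n ]) = begin
      ⟦ Sign.- ℤ.◃ (m ℕ.* suc n) ⟧ℤ  ≡⟨ ≡.cong ⟦_⟧ℤ (ℤ.-◃n≡-n (m ℕ.* suc n)) ⟩
      ⟦ ℤ.- (+ (m ℕ.* suc n)) ⟧ℤ     ≈⟨ -‿homo (+ (m ℕ.* suc n)) ⟩
      - ((m ℕ.* suc n) × 1#)         ≈⟨ -‿cong (×1-homo-* m (suc n)) ⟩
      - ((m × 1#) * (suc n × 1#))    ≈⟨ -‿distribʳ-* _ _ ⟩
      (m × 1#) * - (suc n × 1#)      ∎
    *-homo (-[1+ m ]) (+ n) = begin
      ⟦ Sign.- ℤ.◃ (suc m ℕ.* n) ⟧ℤ  ≡⟨ ≡.cong ⟦_⟧ℤ (ℤ.-◃n≡-n (suc m ℕ.* n)) ⟩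
      ⟦ ℤ.- (+ (suc m ℕ.* n)) ⟧ℤ     ≈⟨ -‿homo (+ (suc m ℕ.* n)) ⟩
      - ((suc m ℕ.* n) × 1#)         ≈⟨ -‿cong (×1-homo-* (suc m) n) ⟩
      - ((suc m × 1#) * (n × 1#))    ≈⟨ -‿distribˡ-* _ _ ⟩
      - (suc m × 1#) * (n × 1#)      ∎
    *-homo (-[1+ m ]) (-[1+ n ]) = begin
      (suc m ℕ.* suc n) × 1#                ≈⟨ ×1-homo-* (suc m) (suc n) ⟩
      (suc m × 1#) * (suc n × 1#)           ≈⟨ -‿involutive _ ⟨
      - (- ((suc m × 1#) * (suc n × 1#)))   ≈⟨ -‿cong (-‿distribˡ-* _ _) ⟩
      - (- (suc m × 1#) * (suc n × 1#))     ≈⟨ -‿distribʳ-* _ _ ⟩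
      - (suc m × 1#) * - (suc n × 1#)       ∎

    morphism : ℤ.+-*-rawRing -Raw-AlmostCommutative⟶ fromCommutativeRing R
    morphism = record
      { ⟦_⟧    = ⟦_⟧ℤ
      ; +-homo = +-homo
      ; *-homo = *-homo
      ; -‿homo = -‿homo
      ; 0-homo = refl
      ; 1-homo = refl
      }

    _≟_ : ∀ i j → Maybe (⟦ i ⟧ℤ ≈ ⟦ j ⟧ℤ)
    i ≟ j with i ℤ.≟ j
    ... | yes ≡.refl = just refl
    ... | no _       = nothing

  open RingSolver ℤ.+-*-rawRing (fromCommutativeRing R) morphism _≟_ public
    using (solve; _:=_; _:+_; _:*_; _:-_; :-_; con)

-- Finite sums over initial segments of the natural numbers.

module FiniteSums {c ℓ} (R : CommutativeRing c ℓ) where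
  open CommutativeRing R
  open RingNotation rawRing using (_×_; sum)
  open SemiringSum semiring
    using (sum-cong-≋; ∑-distrib-+; *-distribˡ-sum; *-distribʳ-sum; sum-replicate; sum-replicate-zero)
  open Mult semiring using (×-assoc-*; ×-congʳ)
  open SetoidReasoning setoid

  ∑< : ℕ → (ℕ → Carrier) → Carrier
  ∑< n f = sum {n} (λ i → f (toℕ i))

  ∑<-cong : ∀ n {f g : ℕ → Carrier} → (∀ i → i < n → f i ≈ g i) → ∑< n f ≈ ∑< n g
  ∑<-cong n f≈g = sum-cong-≋ {n} λ i → f≈g (toℕ i) (Fin.toℕ<n i)

  ∑<-zero : ∀ n {f} → (∀ i → i < n → f i ≈ 0#) → ∑< n f ≈ 0#
  ∑<-zero n f≈0 = trans (∑<-cong n f≈0) (sum-replicate-zero n)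

  ∑<-+ : ∀ n (f g : ℕ → Carrier) → ∑< n (λ i → f i + g i) ≈ ∑< n f + ∑< n g
  ∑<-+ n f g = ∑-distrib-+ {n} (λ i → f (toℕ i)) (λ i → g (toℕ i))

  ∑<-*ˡ : ∀ n x (f : ℕ → Carrier) → ∑< n (λ i → x * f i) ≈ x * ∑< n f
  ∑<-*ˡ n x f = sym (*-distribˡ-sum {n} x (λ i → f (toℕ i)))

  ∑<-*ʳ : ∀ n x (f : ℕ → Carrier) → ∑< n (λ i → f i * x) ≈ ∑< n f * x
  ∑<-*ʳ n x f = sym (*-distribʳ-sum {n} x (λ i → f (toℕ i)))

  ∑<-const : ∀ n x → ∑< n (λ _ → x) ≈ (n × 1#) * x
  ∑<-const n x = begin
    ∑< n (λ _ → x)  ≈⟨ sum-replicate n ⟩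
    n × x           ≈⟨ ×-congʳ n (*-identityˡ x) ⟨
    n × (1# * x)    ≈⟨ ×-assoc-* n 1# x ⟨
    (n × 1#) * x    ∎

  ∑<-++ : ∀ m n (f : ℕ → Carrier) → ∑< (m ℕ.+ n) f ≈ ∑< m f + ∑< n (λ i → f (m ℕ.+ i))
  ∑<-++ zero    n f = sym (+-identityˡ _)
  ∑<-++ (suc m) n f = trans (+-congˡ (∑<-++ m n (λ i → f (suc i)))) (sym (+-assoc _ _ _))

  ∑<-last : ∀ n (f : ℕ → Carrier) → ∑< (suc n) f ≈ ∑< n f + f n
  ∑<-last zero    f = +-comm _ _
  ∑<-last (suc n) f = trans (+-congˡ (∑<-last n (λ i → f (suc i)))) (sym (+-assoc _ _ _))

  ∑<-reverse : ∀ n (f : ℕ → Carrier) → ∑< n (λ i → f (n ∸ suc i)) ≈ ∑< n f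
  ∑<-reverse zero    f = refl
  ∑<-reverse (suc n) f = begin
    f n + ∑< n (λ i → f (n ∸ suc i)) ≈⟨ +-comm _ _ ⟩
    ∑< n (λ i → f (n ∸ suc i)) + f n ≈⟨ +-congʳ (∑<-reverse n f) ⟩
    ∑< n f + f n                     ≈⟨ ∑<-last n f ⟨
    ∑< (suc n) f                     ∎

  ∑<-comm : ∀ m n (f : ℕ → ℕ → Carrier) →
            ∑< m (λ i → ∑< n (f i)) ≈ ∑< n (λ j → ∑< m (λ i → f i j))
  ∑<-comm m n f = SemiringSum.∑-comm semiring {m} {n} (λ i j → f (toℕ i) (toℕ j))

  -- Substitutes i = j + e, so that the gap becomes a summation variable. This gives associativity
  -- of the Cauchy product; the strict form below serves sums over pairs of chain entries, where
  -- partial fractions depend on the gap.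
  ∑<-triangle : ∀ n (f : ℕ → ℕ → Carrier) →
                ∑< n (λ i → ∑< (suc i) (f i)) ≈
                ∑< n (λ j → ∑< (n ∸ j) (λ e → f (j ℕ.+ e) j))
  ∑<-triangle zero    f = refl
  ∑<-triangle (suc n) f = begin
    (f 0 0 + 0#) + ∑< n (λ i → f (suc i) 0 + ∑< (suc i) (λ j → f (suc i) (suc j)))
      ≈⟨ +-cong (+-identityʳ _) (∑<-+ n (λ i → f (suc i) 0) (λ i → ∑< (suc i) (λ j → f (suc i) (suc j)))) ⟩
    f 0 0 + (∑< n (λ i → f (suc i) 0) + ∑< n (λ i → ∑< (suc i) (λ j → f (suc i) (suc j))))
      ≈⟨ +-assoc _ _ _ ⟨
    ∑< (suc n) (λ i → f i 0) + ∑< n (λ i → ∑< (suc i) (λ j → f (suc i) (suc j)))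
      ≈⟨ +-congˡ (∑<-triangle n (λ i j → f (suc i) (suc j))) ⟩
    ∑< (suc n) (λ i → f i 0) + ∑< n (λ j → ∑< (n ∸ j) (λ e → f (suc (j ℕ.+ e)) (suc j))) ∎

  ∑<-strict-triangle : ∀ n (f : ℕ → ℕ → Carrier) →
                       ∑< n (λ i → ∑< i (f i)) ≈
                       ∑< n (λ j → ∑< (n ∸ suc j) (λ e → f (suc j ℕ.+ e) j))
  ∑<-strict-triangle zero    f = refl
  ∑<-strict-triangle (suc n) f = begin
    0# + ∑< n (λ i → ∑< (suc i) (f (suc i)))   ≈⟨ +-identityˡ _ ⟩
    ∑< n (λ i → ∑< (suc i) (f (suc i)))        ≈⟨ ∑<-triangle n (λ i → f (suc i)) ⟩
    ∑< n g                                     ≈⟨ +-identityʳ _ ⟨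
    -- The column j = n of the strict triangle is empty.
    ∑< n g + 0#                                ≡⟨ ≡.cong (λ k → ∑< n g + ∑< k (λ e → f (suc n ℕ.+ e) n)) (ℕ.n∸n≡0 n) ⟨
    ∑< n g + g n                               ≈⟨ ∑<-last n g ⟨
    ∑< (suc n) g                               ∎
    where
    g : ℕ → Carrier
    g j = ∑< (n ∸ j) (λ e → f (suc j ℕ.+ e) j)

-- Ring laws for power series and polynomials.

module SeriesRing {c ℓ} (R : CommutativeRing c ℓ) where
  private
    module R = CommutativeRing R
    module S = RawRing (PowerSeries.rawRing R.rawRing)
    open FiniteSums R
    open SetoidReasoning R.setoid

    *-comm : ∀ f g → f S.* g S.≈ g S.* f
    *-comm f g n = begin
      ∑< (suc n) (λ i → f i R.* g (n ∸ i))              ≈⟨ ∑<-reverse (suc n) (λ i → f i R.* g (n ∸ i)) ⟨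
      ∑< (suc n) (λ i → f (n ∸ i) R.* g (n ∸ (n ∸ i)))  ≈⟨ ∑<-cong (suc n) swap ⟩
      ∑< (suc n) (λ i → g i R.* f (n ∸ i))              ∎
      where
      swap : ∀ i → i < suc n → f (n ∸ i) R.* g (n ∸ (n ∸ i)) R.≈ g i R.* f (n ∸ i)
      swap i (s≤s i≤n) rewrite ℕ.m∸[m∸n]≡n i≤n = R.*-comm _ _

    *-cong : ∀ {f f′ g g′} → f S.≈ f′ → g S.≈ g′ → f S.* g S.≈ f′ S.* g′
    *-cong f≈f′ g≈g′ n = ∑<-cong (suc n) λ i _ → R.*-cong (f≈f′ i) (g≈g′ (n ∸ i))

    *-assoc : ∀ f g h → (f S.* g) S.* h S.≈ f S.* (g S.* h)
    *-assoc f g h n = begin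
      ∑< (suc n) (λ i → ∑< (suc i) (λ j → f j R.* g (i ∸ j)) R.* h (n ∸ i))
        ≈⟨ ∑<-cong (suc n) (λ i _ → R.sym (∑<-*ʳ (suc i) (h (n ∸ i)) (λ j → f j R.* g (i ∸ j)))) ⟩
      ∑< (suc n) (λ i → ∑< (suc i) (λ j → f j R.* g (i ∸ j) R.* h (n ∸ i)))
        ≈⟨ ∑<-triangle (suc n) (λ i j → f j R.* g (i ∸ j) R.* h (n ∸ i)) ⟩
      ∑< (suc n) (λ j → ∑< (suc n ∸ j) (λ e → f j R.* g (j ℕ.+ e ∸ j) R.* h (n ∸ (j ℕ.+ e))))
        ≈⟨ ∑<-cong (suc n) inner ⟩
      ∑< (suc n) (λ j → f j R.* ∑< (suc (n ∸ j)) (λ e → g e R.* h (n ∸ j ∸ e)))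
        ∎
      where
      inner : ∀ j → j < suc n →
        ∑< (suc n ∸ j) (λ e → f j R.* g (j ℕ.+ e ∸ j) R.* h (n ∸ (j ℕ.+ e))) R.≈
        f j R.* ∑< (suc (n ∸ j)) (λ e → g e R.* h (n ∸ j ∸ e))
      inner j (s≤s j≤n) rewrite ℕ.+-∸-assoc 1 j≤n = begin
        ∑< (suc (n ∸ j)) (λ e → f j R.* g (j ℕ.+ e ∸ j) R.* h (n ∸ (j ℕ.+ e)))
          ≈⟨ ∑<-cong (suc (n ∸ j)) (λ e _ → step e) ⟩
        ∑< (suc (n ∸ j)) (λ e → f j R.* (g e R.* h (n ∸ j ∸ e)))
          ≈⟨ ∑<-*ˡ (suc (n ∸ j)) (f j) (λ e → g e R.* h (n ∸ j ∸ e)) ⟩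
        f j R.* ∑< (suc (n ∸ j)) (λ e → g e R.* h (n ∸ j ∸ e))
          ∎
        where
        step : ∀ e → f j R.* g (j ℕ.+ e ∸ j) R.* h (n ∸ (j ℕ.+ e)) R.≈ f j R.* (g e R.* h (n ∸ j ∸ e))
        step e rewrite ℕ.m+n∸m≡n j e | ℕ.∸-+-assoc n j e = R.*-assoc _ _ _

    *-identityˡ : ∀ f → S.1# S.* f S.≈ f
    *-identityˡ f n = begin
      R.1# R.* f n R.+ ∑< n (λ i → R.0# R.* f (n ∸ suc i))
        ≈⟨ R.+-cong (R.*-identityˡ _) (∑<-zero n (λ i _ → R.zeroˡ (f (n ∸ suc i)))) ⟩
      f n R.+ R.0#  ≈⟨ R.+-identityʳ _ ⟩
      f n           ∎

    distribˡ : ∀ f g h → f S.* (g S.+ h) S.≈ f S.* g S.+ f S.* h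
    distribˡ f g h n = R.trans
      (∑<-cong (suc n) λ i _ → R.distribˡ (f i) (g (n ∸ i)) (h (n ∸ i)))
      (∑<-+ (suc n) (λ i → f i R.* g (n ∸ i)) (λ i → f i R.* h (n ∸ i)))

    ≈-trans : ∀ {f g h} → f S.≈ g → g S.≈ h → f S.≈ h
    ≈-trans f≈g g≈h n = R.trans (f≈g n) (g≈h n)

  commutativeRing : CommutativeRing c ℓ
  commutativeRing = record
    { Carrier = S.Carrier ; _≈_ = S._≈_ ; _+_ = S._+_ ; _*_ = S._*_ ; -_ = S.-_ ; 0# = S.0# ; 1# = S.1#
    ; isCommutativeRing = record
      { isRing = record
        { +-isAbelianGroup = record
          { isGroup = record
            { isMonoid = record
              { isSemigroup = record
                { isMagma = record
                  { isEquivalence = record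
                    { refl  = λ _ → R.refl
                    ; sym   = λ f≈g n → R.sym (f≈g n)
                    ; trans = ≈-trans
                    }
                  ; ∙-cong = λ f≈f′ g≈g′ n → R.+-cong (f≈f′ n) (g≈g′ n)
                  }
                ; assoc = λ f g h n → R.+-assoc (f n) (g n) (h n)
                }
              ; identity = (λ f n → R.+-identityˡ (f n)) , (λ f n → R.+-identityʳ (f n))
              }
            ; inverse = (λ f n → R.-‿inverseˡ (f n)) , (λ f n → R.-‿inverseʳ (f n))
            ; ⁻¹-cong = λ f≈g n → R.-‿cong (f≈g n)
            }
          ; comm = λ f g n → R.+-comm (f n) (g n)
          }
        ; *-cong     = *-cong
        ; *-assoc    = *-assoc
        ; *-identity = *-identityˡ , λ f → ≈-trans (*-comm f S.1#) (*-identityˡ f)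
        ; distrib    = distribˡ , λ f g h → ≈-trans (*-comm (g S.+ h) f)
            (≈-trans (distribˡ f g h) λ n → R.+-cong (*-comm f g n) (*-comm f h n))
        }
      ; *-comm = *-comm
      }
    }

module PolynomialRing {c ℓ} (R : CommutativeRing c ℓ) where
  private
    module R where
      open CommutativeRing R public
      open RingProperties ring public using (-0#≈0#)
    open Polynomial R.rawRing using (coeff; add; mul)
    open FiniteSums R
    open SetoidReasoning R.setoid

    coeff-add : ∀ f g n → coeff (add f g) n R.≈ coeff f n R.+ coeff g n
    coeff-add []      g       n       = R.sym (R.+-identityˡ _)
    coeff-add (a ∷ f) []      n       = R.sym (R.+-identityʳ _)
    coeff-add (a ∷ f) (b ∷ g) zero    = R.refl
    coeff-add (a ∷ f) (b ∷ g) (suc n) = coeff-add f g n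

    coeff-scale : ∀ a f n → coeff (map (a R.*_) f) n R.≈ a R.* coeff f n
    coeff-scale a []      n       = R.sym (R.zeroʳ a)
    coeff-scale a (b ∷ f) zero    = R.refl
    coeff-scale a (b ∷ f) (suc n) = coeff-scale a f n

    coeff-neg : ∀ f n → coeff (map R.-_ f) n R.≈ R.- coeff f n
    coeff-neg []      n       = R.sym R.-0#≈0#
    coeff-neg (b ∷ f) zero    = R.refl
    coeff-neg (b ∷ f) (suc n) = coeff-neg f n

    coeff-one : ∀ n → coeff (R.1# ∷ []) n R.≈ RawRing.1# (PowerSeries.rawRing R.rawRing) n
    coeff-one zero    = R.refl
    coeff-one (suc n) = R.refl

    coeff-mul : ∀ f g n → coeff (mul f g) n R.≈ ∑< (suc n) (λ i → coeff f i R.* coeff g (n ∸ i))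
    coeff-mul []      g n = R.sym (∑<-zero (suc n) (λ i _ → R.zeroˡ (coeff g (n ∸ i))))
    coeff-mul (a ∷ f) g n = R.trans
      (coeff-add (map (a R.*_) g) (R.0# ∷ mul f g) n)
      (R.+-cong (coeff-scale a g n) (shift n))
      where
      shift : ∀ n → coeff (R.0# ∷ mul f g) n R.≈ ∑< n (λ i → coeff f i R.* coeff g (n ∸ suc i))
      shift zero    = R.refl
      shift (suc n) = coeff-mul f g n

    -- Polynomials are equal by definition when all their coefficients are, so `coeff` is injective
    -- for free and every ring law is pulled back from power series.
    isRingMonomorphism : IsRingMonomorphism (Polynomial.rawRing R.rawRing) (PowerSeries.rawRing R.rawRing) coeff
    isRingMonomorphism = record
      { isRingHomomorphism = record
        { isSemiringHomomorphism = record
          { isNearSemiringHomomorphism = record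
            { +-isMonoidHomomorphism = record
              { isMagmaHomomorphism = record
                { isRelHomomorphism = record { cong = λ f≈g → f≈g }
                ; homo = coeff-add
                }
              ; ε-homo = λ _ → R.refl
              }
            ; *-homo = coeff-mul
            }
          ; 1#-homo = coeff-one
          }
        ; -‿homo = coeff-neg
        }
      ; injective = λ f≈g → f≈g
      }

  commutativeRing : CommutativeRing c ℓ
  commutativeRing = record
    { isCommutativeRing = RingMonomorphism.isCommutativeRing isRingMonomorphism
        (CommutativeRing.isCommutativeRing (SeriesRing.commutativeRing R)) }

-- Operators that act on functions of indices position by position.

module IndexOperators {c ℓ} (R : CommutativeRing c ℓ) where
  open CommutativeRing R
  open FiniteSums R
  open IntegerSolver R
  open SetoidReasoning setoid

  -- `D φ G 𝐤` sums the local expression φ over all positions of the index 𝐤: at each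
  -- position φ sees the entry, the entries after it, and G applied behind the prefix.
  D : ((List ℕ → Carrier) → ℕ → List ℕ → Carrier) → (List ℕ → Carrier) → List ℕ → Carrier
  D φ G []       = 0#
  D φ G (k ∷ ks) = φ G k ks + D φ (λ 𝐩 → G (k ∷ 𝐩)) ks

  split raise : (List ℕ → Carrier) → ℕ → List ℕ → Carrier
  split G k ks = ∑< (k ∸ 1) λ j → G (k ∸ j ∷ j ℕ.+ 1 ∷ ks)
  raise G k ks = G (k ℕ.+ 1 ∷ ks)

  infix 4 _≈⁺_
  -- The empty index is left out because `ζqᵗ []` is `1#` while `S F []` is `0#`; `D` never
  -- evaluates its argument there. Positivity is what makes the subtractions in `fillings` exact.
  _≈⁺_ : (G G′ : List ℕ → Carrier) → Set ℓ
  G ≈⁺ G′ = ∀ k ks → All (1 ≤_) (k ∷ ks) → G (k ∷ ks) ≈ G′ (k ∷ ks)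

  record IsLinear (φ : (List ℕ → Carrier) → ℕ → List ℕ → Carrier) : Set (c ⊔ ℓ) where
    field
      φ-cong : ∀ {G G′} → G ≈⁺ G′ → ∀ k ks → All (1 ≤_) (k ∷ ks) → φ G k ks ≈ φ G′ k ks
      φ-+    : ∀ G G′ k ks → φ (λ 𝐩 → G 𝐩 + G′ 𝐩) k ks ≈ φ G k ks + φ G′ k ks
      φ-*    : ∀ x G k ks → φ (λ 𝐩 → x * G 𝐩) k ks ≈ x * φ G k ks

  split-linear : IsLinear split
  split-linear = record
    { φ-cong = λ { G≈G′ k ks (_ ∷ 1≤ks) → ∑<-cong (k ∸ 1) λ j j<k∸1 →
        G≈G′ (k ∸ j) (j ℕ.+ 1 ∷ ks)
          (ℕ.m<n⇒0<n∸m (ℕ.<-≤-trans j<k∸1 (ℕ.m∸n≤m k 1)) ∷ ℕ.m≤n+m 1 j ∷ 1≤ks) }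
    ; φ-+ = λ G G′ k ks → ∑<-+ (k ∸ 1) (λ j → G (k ∸ j ∷ j ℕ.+ 1 ∷ ks)) (λ j → G′ (k ∸ j ∷ j ℕ.+ 1 ∷ ks))
    ; φ-* = λ x G k ks → ∑<-*ˡ (k ∸ 1) x (λ j → G (k ∸ j ∷ j ℕ.+ 1 ∷ ks))
    }

  raise-linear : IsLinear raise
  raise-linear = record
    { φ-cong = λ { G≈G′ k ks (_ ∷ 1≤ks) → G≈G′ (k ℕ.+ 1) ks (ℕ.m≤n+m 1 k ∷ 1≤ks) }
    ; φ-+    = λ _ _ _ _ → refl
    ; φ-*    = λ _ _ _ _ → refl
    }

  module _ {φ} (φ-linear : IsLinear φ) where
    open IsLinear φ-linear

    D-cong : ∀ G G′ → G ≈⁺ G′ → ∀ ks → All (1 ≤_) ks → D φ G ks ≈ D φ G′ ks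
    D-cong G G′ G≈G′ []       _                 = refl
    D-cong G G′ G≈G′ (k ∷ ks) 1≤𝐤@(1≤k ∷ 1≤ks) = +-cong (φ-cong G≈G′ k ks 1≤𝐤)
      (D-cong (λ 𝐩 → G (k ∷ 𝐩)) (λ 𝐩 → G′ (k ∷ 𝐩)) (λ k′ ks′ 1≤𝐤′ → G≈G′ k (k′ ∷ ks′) (1≤k ∷ 1≤𝐤′)) ks 1≤ks)

    D-+ : ∀ G G′ ks → D φ (λ 𝐩 → G 𝐩 + G′ 𝐩) ks ≈ D φ G ks + D φ G′ ks
    D-+ G G′ []       = sym (+-identityˡ 0#)
    D-+ G G′ (k ∷ ks) = trans
      (+-cong (φ-+ G G′ k ks) (D-+ (λ 𝐩 → G (k ∷ 𝐩)) (λ 𝐩 → G′ (k ∷ 𝐩)) ks))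
      (solve 4 (λ a b c d → (a :+ b) :+ (c :+ d) := (a :+ c) :+ (b :+ d)) refl _ _ _ _)

    D-*ˡ : ∀ x G ks → D φ (λ 𝐩 → x * G 𝐩) ks ≈ x * D φ G ks
    D-*ˡ x G []       = sym (zeroʳ x)
    D-*ˡ x G (k ∷ ks) = trans
      (+-cong (φ-* x G k ks) (D-*ˡ x (λ 𝐩 → G (k ∷ 𝐩)) ks))
      (sym (distribˡ x _ _))

    D-0 : ∀ ks → All (1 ≤_) ks → D φ (λ _ → 0#) ks ≈ 0#
    D-0 ks 1≤ks = begin
      D φ (λ _ → 0#) ks       ≈⟨ D-cong (λ _ → 0#) (λ _ → 0# * 0#) (λ _ _ _ → sym (zeroˡ 0#)) ks 1≤ks ⟩
      D φ (λ _ → 0# * 0#) ks  ≈⟨ D-*ˡ 0# (λ _ → 0#) ks ⟩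
      0# * D φ (λ _ → 0#) ks  ≈⟨ zeroˡ _ ⟩
      0#                      ∎

    D-∑ : ∀ n (G : ℕ → List ℕ → Carrier) ks → All (1 ≤_) ks →
          D φ (λ 𝐩 → ∑< n (λ i → G i 𝐩)) ks ≈ ∑< n (λ i → D φ (G i) ks)
    D-∑ zero    G ks 1≤ks = D-0 ks 1≤ks
    D-∑ (suc n) G ks 1≤ks = trans
      (D-+ (G 0) (λ 𝐩 → ∑< n (λ i → G (suc i) 𝐩)) ks)
      (+-congˡ (D-∑ n (λ i → G (suc i)) ks 1≤ks))

-- The commutator of splitting with the weighted sum over fillings.

module Interpolation {c ℓ} (R : CommutativeRing c ℓ) (t ħ : CommutativeRing.Carrier R) where
  open CommutativeRing R hiding (_-_)
  open RingNotation rawRing using (_×_; _-_)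
  open Mult semiring using (×-homo-+)
  open FiniteSums R
  open IndexOperators R
  open IntegerSolver R
  open SetoidReasoning setoid

  -- The weighted sum of F over the fillings of (k ∷ ks), one summand for each choice of
  -- the first box.
  S′ : (List ℕ → Carrier) → ℕ → List ℕ → Carrier
  S′ F k []        = F (k ∷ [])
  S′ F k (k′ ∷ ks) =
    S′ (λ 𝐩 → F (k ∷ 𝐩)) k′ ks + t * S′ F (k ℕ.+ k′) ks + ħ * t * S′ F (k ℕ.+ k′ ∸ 1) ks

  S : (List ℕ → Carrier) → List ℕ → Carrier
  S F []       = 0#
  S F (k ∷ ks) = S′ F k ks

  -- Joining a positive entry to the first one, even by "-1+", never lowers it, so a lower bound `h`
  -- on the first entry passes to every filling. The value h = 2 later allows a relation valid only
  -- for k₁ ≥ 2 to be applied under `S`.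
  S′-cong : ∀ h → 1 ≤ h → ∀ {F F′} →
            (∀ k ks → h ≤ k → All (1 ≤_) ks → F (k ∷ ks) ≈ F′ (k ∷ ks)) →
            ∀ k ks → h ≤ k → All (1 ≤_) ks → S′ F k ks ≈ S′ F′ k ks
  S′-cong h 1≤h F≈F′ k []        h≤k []             = F≈F′ k [] h≤k []
  S′-cong h 1≤h F≈F′ k (k′ ∷ ks) h≤k (1≤k′ ∷ 1≤ks) = +-cong
    (+-cong
      (S′-cong 1 ℕ.≤-refl (λ k″ ks′ p ps → F≈F′ k (k″ ∷ ks′) h≤k (p ∷ ps)) k′ ks 1≤k′ 1≤ks)
      (*-congˡ (S′-cong h 1≤h F≈F′ (k ℕ.+ k′) ks (ℕ.≤-trans h≤k (ℕ.m≤m+n k k′)) 1≤ks)))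
    (*-congˡ (S′-cong h 1≤h F≈F′ (k ℕ.+ k′ ∸ 1) ks h≤k+k′∸1 1≤ks))
    where
    h≤k+k′∸1 : h ≤ k ℕ.+ k′ ∸ 1
    h≤k+k′∸1 = ≡.subst (h ≤_) (≡.sym (ℕ.+-∸-assoc k 1≤k′)) (ℕ.≤-trans h≤k (ℕ.m≤m+n k (k′ ∸ 1)))

  S′-+ : ∀ F F′ k ks → S′ (λ 𝐩 → F 𝐩 + F′ 𝐩) k ks ≈ S′ F k ks + S′ F′ k ks
  S′-+ F F′ k []        = refl
  S′-+ F F′ k (k′ ∷ ks) = trans
    (+-cong (+-cong (S′-+ (λ 𝐩 → F (k ∷ 𝐩)) (λ 𝐩 → F′ (k ∷ 𝐩)) k′ ks)
                    (*-congˡ (S′-+ F F′ (k ℕ.+ k′) ks)))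
            (*-congˡ (S′-+ F F′ (k ℕ.+ k′ ∸ 1) ks)))
    (solve 8 (λ t ħt a a′ b b′ c c′ →
      (a :+ a′) :+ t :* (b :+ b′) :+ ħt :* (c :+ c′) :=
      (a :+ t :* b :+ ħt :* c) :+ (a′ :+ t :* b′ :+ ħt :* c′)) refl t (ħ * t) _ _ _ _ _ _)

  S′-0 : ∀ k ks → S′ (λ _ → 0#) k ks ≈ 0#
  S′-0 k []        = refl
  S′-0 k (k′ ∷ ks) = trans
    (+-cong (+-cong (S′-0 k′ ks) (*-congˡ (S′-0 (k ℕ.+ k′) ks))) (*-congˡ (S′-0 (k ℕ.+ k′ ∸ 1) ks)))
    (solve 2 (λ t ħt → con (+ 0) :+ t :* con (+ 0) :+ ħt :* con (+ 0) := con (+ 0)) refl t (ħ * t))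

  S′-∑ : ∀ n (F : ℕ → List ℕ → Carrier) k ks →
         S′ (λ 𝐩 → ∑< n (λ i → F i 𝐩)) k ks ≈ ∑< n (λ i → S′ (F i) k ks)
  S′-∑ zero    F k ks = S′-0 k ks
  S′-∑ (suc n) F k ks = trans
    (S′-+ (F 0) (λ 𝐩 → ∑< n (λ i → F (suc i) 𝐩)) k ks)
    (+-congˡ (S′-∑ n (λ i → F (suc i)) k ks))

  -- The last entry is singled out: there the Kronecker delta is 1 and no following entry can be
  -- merged. The numerals `2 × 1#`, `1 × 1#` and `0 × 1#` stay unsimplified so that the terms agree
  -- definitionally with those of the theorem.
  rhs : (List ℕ → Carrier) → ℕ → List ℕ → Carrier
  rhs G k [] =
    (1# + (k × 1# - 2 × 1# + 1 × 1#) * t) * G (k ℕ.+ 1 ∷ []) + ħ * (t * (k × 1# - 1#) * G (k ∷ []))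
  rhs G k (k′ ∷ ks) =
    (1# + (k × 1# - 2 × 1# + 0 × 1#) * t) * G (k ℕ.+ 1 ∷ k′ ∷ ks)
    + t * (t - 1#) * G (k ℕ.+ k′ ℕ.+ 1 ∷ ks)
    + ħ * (t * (k × 1# - 1#) * G (k ∷ k′ ∷ ks) + t * (t - 1#) * G (k ℕ.+ k′ ∷ ks))

  rhs-linear : IsLinear rhs
  rhs-linear = record { φ-cong = rhs-cong ; φ-+ = rhs-+ ; φ-* = rhs-* }
    where
    rhs-cong : ∀ {G G′} → G ≈⁺ G′ → ∀ k ks → All (1 ≤_) (k ∷ ks) → rhs G k ks ≈ rhs G′ k ks
    rhs-cong G≈G′ k [] 1≤𝐤 =
      +-cong (*-congˡ (G≈G′ _ _ (ℕ.m≤n+m 1 k ∷ []))) (*-congˡ (*-congˡ (G≈G′ _ _ 1≤𝐤)))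
    rhs-cong G≈G′ k (k′ ∷ ks) 1≤𝐤@(1≤k ∷ 1≤k′ ∷ 1≤ks) = +-cong
      (+-cong (*-congˡ (G≈G′ _ _ (ℕ.m≤n+m 1 k ∷ 1≤k′ ∷ 1≤ks)))
              (*-congˡ (G≈G′ _ _ (ℕ.m≤n+m 1 (k ℕ.+ k′) ∷ 1≤ks))))
      (*-congˡ (+-cong (*-congˡ (G≈G′ _ _ 1≤𝐤))
                       (*-congˡ (G≈G′ _ _ (ℕ.≤-trans 1≤k (ℕ.m≤m+n k k′) ∷ 1≤ks)))))
    rhs-+ : ∀ G G′ k ks → rhs (λ 𝐩 → G 𝐩 + G′ 𝐩) k ks ≈ rhs G k ks + rhs G′ k ks
    rhs-+ G G′ k [] = solve 7 (λ a ħ b x x′ y y′ →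
      a :* (x :+ x′) :+ ħ :* (b :* (y :+ y′)) :=
      (a :* x :+ ħ :* (b :* y)) :+ (a :* x′ :+ ħ :* (b :* y′))) refl _ _ _ _ _ _ _
    rhs-+ G G′ k (k′ ∷ ks) = solve 12 (λ a ħ b d x x′ y y′ z z′ w w′ →
      a :* (x :+ x′) :+ d :* (z :+ z′) :+ ħ :* (b :* (y :+ y′) :+ d :* (w :+ w′)) :=
      (a :* x :+ d :* z :+ ħ :* (b :* y :+ d :* w)) :+ (a :* x′ :+ d :* z′ :+ ħ :* (b :* y′ :+ d :* w′)))
      refl _ _ _ _ _ _ _ _ _ _ _ _
    rhs-* : ∀ r G k ks → rhs (λ 𝐩 → r * G 𝐩) k ks ≈ r * rhs G k ks
    rhs-* r G k [] = solve 6 (λ r a ħ b x y →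
      a :* (r :* x) :+ ħ :* (b :* (r :* y)) := r :* (a :* x :+ ħ :* (b :* y))) refl _ _ _ _ _ _
    rhs-* r G k (k′ ∷ ks) = solve 9 (λ r a ħ b d x y z w →
      a :* (r :* x) :+ d :* (r :* z) :+ ħ :* (b :* (r :* y) :+ d :* (r :* w)) :=
      r :* (a :* x :+ d :* z :+ ħ :* (b :* y :+ d :* w))) refl _ _ _ _ _ _ _ _ _

  D-prefix : ∀ {φ} → IsLinear φ → ∀ X Y Z ks →
             D φ (λ 𝐩 → X 𝐩 + t * Y 𝐩 + ħ * t * Z 𝐩) ks ≈ D φ X ks + t * D φ Y ks + ħ * t * D φ Z ks
  D-prefix {φ} φ-linear X Y Z ks = begin
    D φ (λ 𝐩 → X 𝐩 + t * Y 𝐩 + ħ * t * Z 𝐩) ks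
      ≈⟨ D-+ φ-linear (λ 𝐩 → X 𝐩 + t * Y 𝐩) (λ 𝐩 → ħ * t * Z 𝐩) ks ⟩
    D φ (λ 𝐩 → X 𝐩 + t * Y 𝐩) ks + D φ (λ 𝐩 → ħ * t * Z 𝐩) ks
      ≈⟨ +-cong (D-+ φ-linear X (λ 𝐩 → t * Y 𝐩) ks) (D-*ˡ φ-linear (ħ * t) Z ks) ⟩
    D φ X ks + D φ (λ 𝐩 → t * Y 𝐩) ks + ħ * t * D φ Z ks
      ≈⟨ +-congʳ (+-congˡ (D-*ˡ φ-linear t Y ks)) ⟩
    D φ X ks + t * D φ Y ks + ħ * t * D φ Z ks ∎

  -- An entry k before the index is joined to it by "+" for c = k and by "-1+" for c = k - 1.
  shift : ℕ → (List ℕ → Carrier) → List ℕ → Carrier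
  shift c G []       = 0#
  shift c G (k ∷ ks) = G (c ℕ.+ k ∷ ks)

  -- The merged entry c + k can be cut at c + k - 1 places. In k - 1 of them `c` stays joined to the
  -- first piece of a cut of `k`, which is a split of `shift c G`; the other `c` places cut inside
  -- `c`.
  split-shift : ∀ c G k ks → 1 ≤ k →
    D split G (c ℕ.+ k ∷ ks) ≈ D split (shift c G) (k ∷ ks) + ∑< c (λ j → G (suc c ∸ j ∷ k ℕ.+ j ∷ ks))
  split-shift c G (suc b) ks (s≤s _) = begin
    ∑< (c ℕ.+ suc b ∸ 1) f + T                                       ≡⟨ ≡.cong (λ n → ∑< n f + T) bound ⟩
    ∑< (b ℕ.+ c) f + T                                               ≈⟨ +-congʳ (∑<-++ b c f) ⟩
    ∑< b f + ∑< c (λ j → f (b ℕ.+ j)) + T                            ≈⟨ +-congʳ (+-cong (∑<-cong b low) (∑<-cong c high)) ⟩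
    split (shift c G) (suc b) ks + ∑< c (λ j → G (suc c ∸ j ∷ suc b ℕ.+ j ∷ ks)) + T
      ≈⟨ solve 3 (λ x y z → x :+ y :+ z := x :+ z :+ y) refl _ _ _ ⟩
    split (shift c G) (suc b) ks + T + ∑< c (λ j → G (suc c ∸ j ∷ suc b ℕ.+ j ∷ ks)) ∎
    where
    f : ℕ → Carrier
    f j = G (c ℕ.+ suc b ∸ j ∷ j ℕ.+ 1 ∷ ks)
    T : Carrier
    T = D split (λ 𝐩 → G (c ℕ.+ suc b ∷ 𝐩)) ks
    bound : c ℕ.+ suc b ∸ 1 ≡ b ℕ.+ c
    bound = ≡.trans (≡.cong (_∸ 1) (ℕ.+-suc c b)) (ℕ.+-comm c b)
    low : ∀ j → j < b → f j ≈ G (c ℕ.+ (suc b ∸ j) ∷ j ℕ.+ 1 ∷ ks)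
    low j j<b = reflexive (≡.cong (λ x → G (x ∷ j ℕ.+ 1 ∷ ks)) (ℕ.+-∸-assoc c (ℕ.m≤n⇒m≤1+n (ℕ.<⇒≤ j<b))))
    high : ∀ j → j < c → f (b ℕ.+ j) ≈ G (suc c ∸ j ∷ suc b ℕ.+ j ∷ ks)
    high j _ = reflexive (≡.cong₂ (λ x y → G (x ∷ y ∷ ks))
      (≡.trans (≡.cong (_∸ (b ℕ.+ j)) (≡.trans (ℕ.+-suc c b) (≡.trans (≡.cong suc (ℕ.+-comm c b)) (≡.sym (ℕ.+-suc b c)))))
               (ℕ.[m+n]∸[m+o]≡n∸o b (suc c) j))
      (ℕ.+-comm (b ℕ.+ j) 1))

  -- Only the two coefficients that are affine in the entry notice the shift, and both have slope
  -- `t`; the merging terms match by associativity.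
  rhs-shift : ∀ c G k ks →
    D rhs G (c ℕ.+ k ∷ ks) ≈
    D rhs (shift c G) (k ∷ ks) + (c × 1#) * (t * (G (c ℕ.+ k ℕ.+ 1 ∷ ks) + ħ * G (c ℕ.+ k ∷ ks)))
  rhs-shift c G k [] = begin
    (1# + ((c ℕ.+ k) × 1# - 2 × 1# + 1 × 1#) * t) * g₁ + ħ * (t * ((c ℕ.+ k) × 1# - 1#) * g₀) + 0#
      ≈⟨ +-congʳ (+-cong (*-congʳ (+-congˡ (*-congʳ (+-congʳ (+-congʳ c+k)))))
                         (*-congˡ (*-congʳ (*-congˡ (+-congʳ c+k))))) ⟩
    (1# + (c × 1# + k × 1# - 2 × 1# + 1 × 1#) * t) * g₁ + ħ * (t * (c × 1# + k × 1# - 1#) * g₀) + 0#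
      -- `2 × 1#` unfolds to `1# + (1# + 0#)`, and the solver expressions copy this shape so that
      -- they evaluate to the goal by reduction.
      ≈⟨ solve 6 (λ t ħ c k g₁ g₀ →
           (con (+ 1) :+ (c :+ k :- (con (+ 1) :+ (con (+ 1) :+ con (+ 0))) :+ (con (+ 1) :+ con (+ 0))) :* t) :* g₁
             :+ ħ :* (t :* (c :+ k :- con (+ 1)) :* g₀) :+ con (+ 0) :=
           (con (+ 1) :+ (k :- (con (+ 1) :+ (con (+ 1) :+ con (+ 0))) :+ (con (+ 1) :+ con (+ 0))) :* t) :* g₁
             :+ ħ :* (t :* (k :- con (+ 1)) :* g₀) :+ con (+ 0) :+ c :* (t :* (g₁ :+ ħ :* g₀)))
           refl t ħ (c × 1#) (k × 1#) g₁ g₀ ⟩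
    (1# + (k × 1# - 2 × 1# + 1 × 1#) * t) * g₁ + ħ * (t * (k × 1# - 1#) * g₀) + 0#
      + (c × 1#) * (t * (g₁ + ħ * g₀))
      ≡⟨ ≡.cong (λ x → (1# + (k × 1# - 2 × 1# + 1 × 1#) * t) * G (x ∷ []) + ħ * (t * (k × 1# - 1#) * g₀) + 0#
           + (c × 1#) * (t * (g₁ + ħ * g₀))) (ℕ.+-assoc c k 1) ⟩
    D rhs (shift c G) (k ∷ []) + (c × 1#) * (t * (g₁ + ħ * g₀)) ∎
    where
    g₁ g₀ : Carrier
    g₁ = G (c ℕ.+ k ℕ.+ 1 ∷ [])
    g₀ = G (c ℕ.+ k ∷ [])
    c+k : (c ℕ.+ k) × 1# ≈ c × 1# + k × 1#
    c+k = ×-homo-+ 1# c k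
  rhs-shift c G k (k′ ∷ ks) = begin
    (1# + ((c ℕ.+ k) × 1# - 2 × 1# + 0 × 1#) * t) * g₁ + t * (t - 1#) * G (c ℕ.+ k ℕ.+ k′ ℕ.+ 1 ∷ ks)
      + ħ * (t * ((c ℕ.+ k) × 1# - 1#) * g₀ + t * (t - 1#) * G (c ℕ.+ k ℕ.+ k′ ∷ ks)) + T
      ≡⟨ ≡.cong₂ (λ x y → (1# + ((c ℕ.+ k) × 1# - 2 × 1# + 0 × 1#) * t) * g₁ + t * (t - 1#) * G (x ∷ ks)
           + ħ * (t * ((c ℕ.+ k) × 1# - 1#) * g₀ + t * (t - 1#) * G (y ∷ ks)) + T) assoc₁ (ℕ.+-assoc c k k′) ⟩
    (1# + ((c ℕ.+ k) × 1# - 2 × 1# + 0 × 1#) * t) * g₁ + t * (t - 1#) * h₁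
      + ħ * (t * ((c ℕ.+ k) × 1# - 1#) * g₀ + t * (t - 1#) * h₀) + T
      ≈⟨ +-congʳ (+-cong (+-congʳ (*-congʳ (+-congˡ (*-congʳ (+-congʳ (+-congʳ c+k))))))
                         (*-congˡ (+-congʳ (*-congʳ (*-congˡ (+-congʳ c+k)))))) ⟩
    (1# + (c × 1# + k × 1# - 2 × 1# + 0 × 1#) * t) * g₁ + t * (t - 1#) * h₁
      + ħ * (t * (c × 1# + k × 1# - 1#) * g₀ + t * (t - 1#) * h₀) + T
      ≈⟨ solve 9 (λ t ħ c k g₁ g₀ h₁ h₀ T →
           (con (+ 1) :+ (c :+ k :- (con (+ 1) :+ (con (+ 1) :+ con (+ 0))) :+ con (+ 0)) :* t) :* g₁
             :+ t :* (t :- con (+ 1)) :* h₁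
             :+ ħ :* (t :* (c :+ k :- con (+ 1)) :* g₀ :+ t :* (t :- con (+ 1)) :* h₀) :+ T :=
           (con (+ 1) :+ (k :- (con (+ 1) :+ (con (+ 1) :+ con (+ 0))) :+ con (+ 0)) :* t) :* g₁
             :+ t :* (t :- con (+ 1)) :* h₁
             :+ ħ :* (t :* (k :- con (+ 1)) :* g₀ :+ t :* (t :- con (+ 1)) :* h₀) :+ T
             :+ c :* (t :* (g₁ :+ ħ :* g₀)))
           refl t ħ (c × 1#) (k × 1#) g₁ g₀ h₁ h₀ T ⟩
    (1# + (k × 1# - 2 × 1# + 0 × 1#) * t) * g₁ + t * (t - 1#) * h₁
      + ħ * (t * (k × 1# - 1#) * g₀ + t * (t - 1#) * h₀) + T
      + (c × 1#) * (t * (g₁ + ħ * g₀))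
      ≡⟨ ≡.cong (λ x → (1# + (k × 1# - 2 × 1# + 0 × 1#) * t) * G (x ∷ k′ ∷ ks) + t * (t - 1#) * h₁
           + ħ * (t * (k × 1# - 1#) * g₀ + t * (t - 1#) * h₀) + T
           + (c × 1#) * (t * (g₁ + ħ * g₀))) (ℕ.+-assoc c k 1) ⟩
    D rhs (shift c G) (k ∷ k′ ∷ ks) + (c × 1#) * (t * (g₁ + ħ * g₀)) ∎
    where
    g₁ g₀ h₁ h₀ T : Carrier
    g₁ = G (c ℕ.+ k ℕ.+ 1 ∷ k′ ∷ ks)
    g₀ = G (c ℕ.+ k ∷ k′ ∷ ks)
    h₁ = G (c ℕ.+ (k ℕ.+ k′ ℕ.+ 1) ∷ ks)
    h₀ = G (c ℕ.+ (k ℕ.+ k′) ∷ ks)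
    T  = D rhs (λ 𝐩 → G (c ℕ.+ k ∷ 𝐩)) (k′ ∷ ks)
    c+k : (c ℕ.+ k) × 1# ≈ c × 1# + k × 1#
    c+k = ×-homo-+ 1# c k
    assoc₁ : c ℕ.+ k ℕ.+ k′ ℕ.+ 1 ≡ c ℕ.+ (k ℕ.+ k′ ℕ.+ 1)
    assoc₁ = ≡.trans (≡.cong (ℕ._+ 1) (ℕ.+-assoc c k k′)) (ℕ.+-assoc c (k ℕ.+ k′) 1)

  ∑<-prefix : ∀ n (X Y Z : ℕ → Carrier) →
              ∑< n (λ i → X i + t * Y i + ħ * t * Z i) ≈ ∑< n X + t * ∑< n Y + ħ * t * ∑< n Z
  ∑<-prefix n X Y Z = begin
    ∑< n (λ i → X i + t * Y i + ħ * t * Z i)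
      ≈⟨ ∑<-+ n (λ i → X i + t * Y i) (λ i → ħ * t * Z i) ⟩
    ∑< n (λ i → X i + t * Y i) + ∑< n (λ i → ħ * t * Z i)
      ≈⟨ +-cong (∑<-+ n X (λ i → t * Y i)) (∑<-*ˡ n (ħ * t) Z) ⟩
    ∑< n X + ∑< n (λ i → t * Y i) + ħ * t * ∑< n Z
      ≈⟨ +-congʳ (+-congˡ (∑<-*ˡ n t Y)) ⟩
    ∑< n X + t * ∑< n Y + ħ * t * ∑< n Z ∎

  ∑<-offset : ∀ n (f g : ℕ → Carrier) r → (∀ i → i < n → f i ≈ g i + r) →
              ∑< n f ≈ ∑< n g + (n × 1#) * r
  ∑<-offset n f g r f≈g+r = begin
    ∑< n f                     ≈⟨ ∑<-cong n f≈g+r ⟩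
    ∑< n (λ i → g i + r)       ≈⟨ ∑<-+ n g (λ _ → r) ⟩
    ∑< n g + ∑< n (λ _ → r)    ≈⟨ +-congˡ (∑<-const n r) ⟩
    ∑< n g + (n × 1#) * r      ∎

  private
    restore : ∀ {j k} m → j ≤ k → k ∸ j ℕ.+ (m ℕ.+ j) ≡ k ℕ.+ m
    restore {j} {k} m j≤k = ≡.trans (≡.cong (k ∸ j ℕ.+_) (ℕ.+-comm m j))
      (≡.trans (≡.sym (ℕ.+-assoc (k ∸ j) j m)) (≡.cong (ℕ._+ m) (ℕ.m∸n+n≡m j≤k)))

  module InductionStep (F : List ℕ → Carrier) (a k′ : ℕ) (ks : List ℕ) where
    private
      k : ℕ
      k = suc a
      α : Carrier
      α = a × 1#
      G : List ℕ → Carrier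
      G = S F
      g₀ g₁ g₂ e₀ e₁ : Carrier
      g₀ = S′ F (a ℕ.+ k′) ks
      g₁ = S′ F (k ℕ.+ k′) ks
      g₂ = S′ F (k ℕ.+ k′ ℕ.+ 1) ks
      e₀ = S′ F k (k′ ∷ ks)
      e₁ = S′ F (k ℕ.+ 1) (k′ ∷ ks)
      V P Q : ℕ → Carrier
      V j = S′ (λ 𝐩 → F (k ∸ j ∷ j ℕ.+ 1 ∷ 𝐩)) k′ ks
      P j = S′ (λ 𝐩 → F (k ∸ j ∷ 𝐩)) (k′ ℕ.+ suc j) ks
      Q j = S′ (λ 𝐩 → F (k ∸ j ∷ 𝐩)) (k′ ℕ.+ j) ks

    -- A comma between the two pieces leaves the three fillings of the next box, `V`, `P` and `Q`.
    -- "+" and "-1+" glue the pieces back to k + 1 and `k`, whatever the cut was, so these terms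
    -- occur `α` = k - 1 times.
    split-first : split G k (k′ ∷ ks) ≈
      ∑< a V + t * ∑< a P + ħ * t * ∑< a Q + α * (t * e₁ + ħ * t * e₀)
    split-first = trans
      (∑<-offset a (λ j → G (k ∸ j ∷ j ℕ.+ 1 ∷ k′ ∷ ks)) (λ j → V j + t * P j + ħ * t * Q j) _ term)
      (+-congʳ (∑<-prefix a V P Q))
      where
      term : ∀ j → j < a → G (k ∸ j ∷ j ℕ.+ 1 ∷ k′ ∷ ks) ≈ (V j + t * P j + ħ * t * Q j) + (t * e₁ + ħ * t * e₀)
      term j j<a = begin
        V j + t * Fₖ (j ℕ.+ 1 ℕ.+ k′) + ħ * t * Fₖ (j ℕ.+ 1 ℕ.+ k′ ∸ 1)
          + t * F₂ (k ∸ j ℕ.+ (j ℕ.+ 1)) + ħ * t * F₂ (k ∸ j ℕ.+ (j ℕ.+ 1) ∸ 1)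
          ≡⟨ ≡.cong₂ (λ x y → V j + t * Fₖ x + ħ * t * Fₖ (x ∸ 1) + t * F₂ y + ħ * t * F₂ (y ∸ 1)) eq₁ eq₂ ⟩
        V j + t * P j + ħ * t * Fₖ (k′ ℕ.+ suc j ∸ 1) + t * e₁ + ħ * t * F₂ (k ℕ.+ 1 ∸ 1)
          ≡⟨ ≡.cong₂ (λ x y → V j + t * P j + ħ * t * Fₖ x + t * e₁ + ħ * t * F₂ y)
               (≡.cong (_∸ 1) (ℕ.+-suc k′ j)) (ℕ.m+n∸n≡m k 1) ⟩
        V j + t * P j + ħ * t * Q j + t * e₁ + ħ * t * e₀
          ≈⟨ +-assoc _ _ _ ⟩
        (V j + t * P j + ħ * t * Q j) + (t * e₁ + ħ * t * e₀) ∎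
        where
        Fₖ F₂ : ℕ → Carrier
        Fₖ x = S′ (λ 𝐩 → F (k ∸ j ∷ 𝐩)) x ks
        F₂ x = S′ F x (k′ ∷ ks)
        eq₁ : j ℕ.+ 1 ℕ.+ k′ ≡ k′ ℕ.+ suc j
        eq₁ = ≡.trans (ℕ.+-comm (j ℕ.+ 1) k′) (≡.cong (k′ ℕ.+_) (ℕ.+-comm j 1))
        eq₂ : k ∸ j ℕ.+ (j ℕ.+ 1) ≡ k ℕ.+ 1
        eq₂ = ≡.trans (≡.cong (k ∸ j ℕ.+_) (ℕ.+-comm j 1)) (restore 1 (ℕ.m≤n⇒m≤1+n (ℕ.<⇒≤ j<a)))

    private
      restored : ∀ m j → j < a → k ∸ j ℕ.+ (k′ ℕ.+ (m ℕ.+ j)) ≡ k ℕ.+ k′ ℕ.+ m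
      restored m j j<a = ≡.trans (≡.cong (k ∸ j ℕ.+_) (≡.sym (ℕ.+-assoc k′ m j)))
        (≡.trans (restore (k′ ℕ.+ m) (ℕ.m≤n⇒m≤1+n (ℕ.<⇒≤ j<a))) (≡.sym (ℕ.+-assoc k k′ m)))

    -- These are the cuts inside `c` of `split-shift` for c = k. The cut j = 0 is the raised index
    -- `e₁`; the others reproduce the `P` of `split-first`, and `moved₀` reproduces the `Q`, so that
    -- both cancel in `step`.
    moved₁ : ∑< k (λ j → G (suc k ∸ j ∷ k′ ℕ.+ j ∷ ks)) ≈
             e₁ + (∑< a P + α * (t * g₂ + ħ * t * g₁))
    moved₁ = +-cong
      (reflexive (≡.cong₂ (λ x y → G (x ∷ y ∷ ks)) (ℕ.+-comm 1 k) (ℕ.+-identityʳ k′)))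
      (∑<-offset a (λ j → G (k ∸ j ∷ k′ ℕ.+ suc j ∷ ks)) P _ term)
      where
      term : ∀ j → j < a → G (k ∸ j ∷ k′ ℕ.+ suc j ∷ ks) ≈ P j + (t * g₂ + ħ * t * g₁)
      term j j<a rewrite restored 1 j j<a | ℕ.m+n∸n≡m (k ℕ.+ k′) 1 = +-assoc _ _ _

    moved₀ : ∑< a (λ j → G (k ∸ j ∷ k′ ℕ.+ j ∷ ks)) ≈ ∑< a Q + α * (t * g₁ + ħ * t * g₀)
    moved₀ = ∑<-offset a (λ j → G (k ∸ j ∷ k′ ℕ.+ j ∷ ks)) Q _ term
      where
      term : ∀ j → j < a → G (k ∸ j ∷ k′ ℕ.+ j ∷ ks) ≈ Q j + (t * g₁ + ħ * t * g₀)
      term j j<a rewrite restored 0 j j<a | ℕ.+-identityʳ (a ℕ.+ k′) = +-assoc _ _ _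

    raise-first : e₁ ≈ S′ (λ 𝐩 → F (k ℕ.+ 1 ∷ 𝐩)) k′ ks + t * g₂ + ħ * t * g₁
    raise-first = reflexive (≡.cong₂
      (λ x y → S′ (λ 𝐩 → F (k ℕ.+ 1 ∷ 𝐩)) k′ ks + t * S′ F x ks + ħ * t * S′ F y ks)
      eq (≡.trans (≡.cong (_∸ 1) eq) (ℕ.m+n∸n≡m (k ℕ.+ k′) 1)))
      where
      eq : k ℕ.+ 1 ℕ.+ k′ ≡ k ℕ.+ k′ ℕ.+ 1
      eq = ≡.trans (ℕ.+-assoc k 1 k′) (≡.trans (≡.cong (k ℕ.+_) (ℕ.+-comm 1 k′)) (≡.sym (ℕ.+-assoc k k′ 1)))

    module _
      (1≤𝐤′ : All (1 ≤_) (k′ ∷ ks))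
      (ihₖ : D split (S (λ 𝐩 → F (k ∷ 𝐩))) (k′ ∷ ks) + S′ (D raise (λ 𝐩 → F (k ∷ 𝐩))) k′ ks ≈
             D rhs (S (λ 𝐩 → F (k ∷ 𝐩))) (k′ ∷ ks) + S′ (D split (λ 𝐩 → F (k ∷ 𝐩))) k′ ks)
      (ih₁ : D split G (k ℕ.+ k′ ∷ ks) + S′ (D raise F) (k ℕ.+ k′) ks ≈
             D rhs G (k ℕ.+ k′ ∷ ks) + S′ (D split F) (k ℕ.+ k′) ks)
      (ih₀ : D split G (a ℕ.+ k′ ∷ ks) + S′ (D raise F) (a ℕ.+ k′) ks ≈
             D rhs G (a ℕ.+ k′ ∷ ks) + S′ (D split F) (a ℕ.+ k′) ks) where

      private
        Fₖ : List ℕ → Carrier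
        Fₖ 𝐩 = F (k ∷ 𝐩)
        prefixed : List ℕ → Carrier
        prefixed 𝐩 = S Fₖ 𝐩 + t * shift k G 𝐩 + ħ * t * shift a G 𝐩
        DS DR : Carrier
        DS = D split (λ 𝐩 → G (k ∷ 𝐩)) (k′ ∷ ks)
        DR = D rhs (λ 𝐩 → G (k ∷ 𝐩)) (k′ ∷ ks)
        Rₖ R₁ R₀ Sₖ S₁ S₀ Uₖ U₁ U₀ M₁ M₀ N₁ N₀ : Carrier
        Rₖ = D rhs (S Fₖ) (k′ ∷ ks)
        R₁ = D rhs G (k ℕ.+ k′ ∷ ks)
        R₀ = D rhs G (a ℕ.+ k′ ∷ ks)
        Sₖ = S′ (D split Fₖ) k′ ks
        S₁ = S′ (D split F) (k ℕ.+ k′) ks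
        S₀ = S′ (D split F) (a ℕ.+ k′) ks
        Uₖ = S′ (D raise Fₖ) k′ ks
        U₁ = S′ (D raise F) (k ℕ.+ k′) ks
        U₀ = S′ (D raise F) (a ℕ.+ k′) ks
        M₁ = D split (shift k G) (k′ ∷ ks)
        M₀ = D split (shift a G) (k′ ∷ ks)
        N₁ = D rhs (shift k G) (k′ ∷ ks)
        N₀ = D rhs (shift a G) (k′ ∷ ks)

        move : ∀ {x y u v} → x + y ≈ u + v → x ≈ u + v - y
        move {x} {y} {u} {v} eq = begin
          x          ≈⟨ solve 2 (λ x y → x := x :+ y :- y) refl x y ⟩
          x + y - y  ≈⟨ +-congʳ eq ⟩
          u + v - y  ∎

        un-add : ∀ {x y z} → x ≈ y + z → y ≈ x - z
        un-add {x} {y} {z} eq = begin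
          y          ≈⟨ solve 2 (λ y z → y := y :+ z :- z) refl y z ⟩
          y + z - z  ≈⟨ +-congʳ eq ⟨
          x - z      ∎

        M₁-eq : M₁ ≈ (R₁ + S₁ - U₁) - (e₁ + (∑< a P + α * (t * g₂ + ħ * t * g₁)))
        M₁-eq = trans (un-add (split-shift k G k′ ks (All.head 1≤𝐤′))) (+-cong (move ih₁) (-‿cong moved₁))

        M₀-eq : M₀ ≈ (R₀ + S₀ - U₀) - (∑< a Q + α * (t * g₁ + ħ * t * g₀))
        M₀-eq = trans (un-add (split-shift a G k′ ks (All.head 1≤𝐤′))) (+-cong (move ih₀) (-‿cong moved₀))

        DS-eq : DS ≈ (Rₖ + Sₖ - Uₖ) + t * ((R₁ + S₁ - U₁) - (e₁ + (∑< a P + α * (t * g₂ + ħ * t * g₁))))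
                      + ħ * t * ((R₀ + S₀ - U₀) - (∑< a Q + α * (t * g₁ + ħ * t * g₀)))
        DS-eq = begin
          DS ≈⟨ D-cong split-linear (λ 𝐩 → G (k ∷ 𝐩)) prefixed (λ _ _ _ → refl) (k′ ∷ ks) 1≤𝐤′ ⟩
          D split prefixed (k′ ∷ ks)
            ≈⟨ D-prefix split-linear (S Fₖ) (shift k G) (shift a G) (k′ ∷ ks) ⟩
          D split (S Fₖ) (k′ ∷ ks) + t * M₁ + ħ * t * M₀
            ≈⟨ +-cong (+-cong (move ihₖ) (*-congˡ M₁-eq)) (*-congˡ M₀-eq) ⟩
          _ ∎

        N₁-eq : N₁ ≈ R₁ - (1# + α) * (t * (g₂ + ħ * g₁))
        N₁-eq = un-add (rhs-shift k G k′ ks)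

        N₀-eq : N₀ ≈ R₀ - α * (t * (g₁ + ħ * g₀))
        N₀-eq = trans (un-add (rhs-shift a G k′ ks)) (+-congˡ (-‿cong (*-congˡ (*-congˡ
          (+-congʳ (reflexive (≡.cong (λ x → S′ F x ks) (ℕ.+-comm (a ℕ.+ k′) 1))))))))

        DR-eq : DR ≈ Rₖ + t * (R₁ - (1# + α) * (t * (g₂ + ħ * g₁)))
                      + ħ * t * (R₀ - α * (t * (g₁ + ħ * g₀)))
        DR-eq = begin
          DR ≈⟨ D-cong rhs-linear (λ 𝐩 → G (k ∷ 𝐩)) prefixed (λ _ _ _ → refl) (k′ ∷ ks) 1≤𝐤′ ⟩
          D rhs prefixed (k′ ∷ ks)
            ≈⟨ D-prefix rhs-linear (S Fₖ) (shift k G) (shift a G) (k′ ∷ ks) ⟩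
          Rₖ + t * N₁ + ħ * t * N₀
            ≈⟨ +-cong (+-congˡ (*-congˡ N₁-eq)) (*-congˡ N₀-eq) ⟩
          _ ∎

        raise-eq : S′ (D raise F) k (k′ ∷ ks) ≈ e₁ - (t * g₂ + ħ * t * g₁) + Uₖ + t * U₁ + ħ * t * U₀
        raise-eq = +-congʳ (+-congʳ (trans
          (S′-+ (λ 𝐩 → F (k ℕ.+ 1 ∷ 𝐩)) (D raise Fₖ) k′ ks)
          (+-congʳ (un-add (trans raise-first (+-assoc _ _ _))))))

        split-eq : S′ (D split F) k (k′ ∷ ks) ≈ ∑< a V + Sₖ + t * S₁ + ħ * t * S₀
        split-eq = +-congʳ (+-congʳ (trans
          (S′-+ (λ 𝐩 → split F k 𝐩) (D split Fₖ) k′ ks)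
          (+-congʳ (S′-∑ a (λ j 𝐩 → F (k ∸ j ∷ j ℕ.+ 1 ∷ 𝐩)) k′ ks))))

      step : D split G (k ∷ k′ ∷ ks) + S′ (D raise F) k (k′ ∷ ks) ≈
             D rhs G (k ∷ k′ ∷ ks) + S′ (D split F) k (k′ ∷ ks)
      step = begin
        split G k (k′ ∷ ks) + DS + S′ (D raise F) k (k′ ∷ ks)
          ≈⟨ +-cong (+-cong split-first DS-eq) raise-eq ⟩
        -- The sums `P` and `Q` cancel between the split first entry and the cuts inside merged
        -- entries. The coefficient k of `rhs` appears as 1 + α because `suc a × 1#` reduces to
        -- `1# + α`.
        _ ≈⟨ solve 20 (λ t ħ α g₀ g₁ g₂ e₀ e₁ V P Q Rₖ R₁ R₀ Sₖ S₁ S₀ Uₖ U₁ U₀ →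
               let one = con (+ 1); zer = con (+ 0) in
               (V :+ t :* P :+ ħ :* t :* Q :+ α :* (t :* e₁ :+ ħ :* t :* e₀)) :+
               ((Rₖ :+ Sₖ :- Uₖ) :+ t :* ((R₁ :+ S₁ :- U₁) :- (e₁ :+ (P :+ α :* (t :* g₂ :+ ħ :* t :* g₁))))
                  :+ ħ :* t :* ((R₀ :+ S₀ :- U₀) :- (Q :+ α :* (t :* g₁ :+ ħ :* t :* g₀))))
               :+ (e₁ :- (t :* g₂ :+ ħ :* t :* g₁) :+ Uₖ :+ t :* U₁ :+ ħ :* t :* U₀)
               :=
               ((one :+ ((one :+ α) :- (one :+ (one :+ zer)) :+ zer) :* t) :* e₁
                 :+ t :* (t :- one) :* g₂
                 :+ ħ :* (t :* ((one :+ α) :- one) :* e₀ :+ t :* (t :- one) :* g₁))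
               :+ (Rₖ :+ t :* (R₁ :- (one :+ α) :* (t :* (g₂ :+ ħ :* g₁)))
                      :+ ħ :* t :* (R₀ :- α :* (t :* (g₁ :+ ħ :* g₀))))
               :+ (V :+ Sₖ :+ t :* S₁ :+ ħ :* t :* S₀))
             refl t ħ α g₀ g₁ g₂ e₀ e₁ (∑< a V) (∑< a P) (∑< a Q) Rₖ R₁ R₀ Sₖ S₁ S₀ Uₖ U₁ U₀ ⟩
        _ ≈⟨ +-cong (+-congˡ DR-eq) split-eq ⟨
        rhs G k (k′ ∷ ks) + DR + S′ (D split F) k (k′ ∷ ks) ∎

  -- Induction on the tail with one recursive call for each filling of the first box, which is why
  -- `F` and `k` vary. With an empty tail, the only box is the one between the two pieces of a
  -- split; its "+" and "-1+" fillings, k - 1 times each, give the terms of `rhs` with `t`.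
  commutator : ∀ F k ks → 1 ≤ k → All (1 ≤_) ks →
    D split (S F) (k ∷ ks) + S′ (D raise F) k ks ≈ D rhs (S F) (k ∷ ks) + S′ (D split F) k ks
  commutator F (suc a) [] _ [] = begin
    split (S F) k [] + 0# + (F (k ℕ.+ 1 ∷ []) + 0#)
      ≈⟨ +-congʳ (+-congʳ (∑<-offset a _ (λ j → F (k ∸ j ∷ j ℕ.+ 1 ∷ [])) (t * F (k ℕ.+ 1 ∷ []) + ħ * t * F (k ∷ [])) term)) ⟩
    split F k [] + α * (t * F (k ℕ.+ 1 ∷ []) + ħ * t * F (k ∷ [])) + 0# + (F (k ℕ.+ 1 ∷ []) + 0#)
      ≈⟨ solve 6 (λ t ħ α s x y → let one = con (+ 1); zer = con (+ 0) in
           s :+ α :* (t :* x :+ ħ :* t :* y) :+ zer :+ (x :+ zer) :=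
           ((one :+ ((one :+ α) :- (one :+ (one :+ zer)) :+ (one :+ zer)) :* t) :* x
             :+ ħ :* (t :* ((one :+ α) :- one) :* y)) :+ zer :+ (s :+ zer))
         refl t ħ α (split F k []) (F (k ℕ.+ 1 ∷ [])) (F (k ∷ [])) ⟩
    rhs (S F) k [] + 0# + (split F k [] + 0#) ∎
    where
    k : ℕ
    k = suc a
    α : Carrier
    α = a × 1#
    term : ∀ j → j < a → S F (k ∸ j ∷ j ℕ.+ 1 ∷ []) ≈
           F (k ∸ j ∷ j ℕ.+ 1 ∷ []) + (t * F (k ℕ.+ 1 ∷ []) + ħ * t * F (k ∷ []))
    term j j<a rewrite ℕ.+-comm j 1 | restore 1 (ℕ.m≤n⇒m≤1+n (ℕ.<⇒≤ j<a)) | ℕ.+-comm a 1 = +-assoc _ _ _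
  commutator F (suc a) (k′ ∷ ks) _ 1≤𝐤′@(1≤k′ ∷ 1≤ks) = InductionStep.step F a k′ ks 1≤𝐤′
    (commutator (λ 𝐩 → F (suc a ∷ 𝐩)) k′ ks 1≤k′ 1≤ks)
    (commutator F (suc a ℕ.+ k′) ks (s≤s z≤n) 1≤ks)
    (commutator F (a ℕ.+ k′) ks (ℕ.≤-trans 1≤k′ (ℕ.m≤n+m k′ a)) 1≤ks)

-- The relation at t = 0 for sums cut off at m₁ ≤ M.

-- Index i of u, x and w stands for m = i + 1: u i is 1/[m], x i is q^m/[m], and w k i is the
-- factor q^((k-1)m)/[m]^k of a summand of ζq.
module TruncatedHoffman {c ℓ} (R : CommutativeRing c ℓ)
  (u x : ℕ → CommutativeRing.Carrier R) (w : ℕ → ℕ → CommutativeRing.Carrier R) where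
  open CommutativeRing R hiding (_-_)
  open RingNotation rawRing using (_^_; _-_)
  open FiniteSums R
  open IndexOperators R
  open IntegerSolver R
  open SetoidReasoning setoid

  Z : ℕ → List ℕ → Carrier
  Z M []       = 1#
  Z M (k ∷ ks) = ∑< M λ i → w k i * Z i ks

  h : ℕ → Carrier
  h n = ∑< n x

  -- The sum of q^d/[d] over M - m < d ≤ M.
  top : ℕ → ℕ → Carrier
  top M i = ∑< (suc i) λ e → x (M ∸ suc i ℕ.+ e)

  -- The amount by which the product of the q-harmonic sum `h M` with `Z M` exceeds their
  -- convolution, by `h*Z`.
  E : ℕ → List ℕ → Carrier
  E M []       = 0#
  E M (k ∷ ks) = ∑< M λ i → w k i * Z i ks * top M i

  h-top : ∀ M i → i < M → h M ≈ h (M ∸ suc i) + top M i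
  h-top M i i<M = begin
    h M                            ≡⟨ ≡.cong h (ℕ.m∸n+n≡m i<M) ⟨
    h (M ∸ suc i ℕ.+ suc i)        ≈⟨ ∑<-++ (M ∸ suc i) (suc i) x ⟩
    h (M ∸ suc i) + top M i        ∎

  -- Index `N ∸ suc i` of `x` stands for d = N - i, so this runs over d + i = N.
  Conv : ℕ → List ℕ → Carrier
  Conv N ks = ∑< N λ i → x (N ∸ suc i) * Z i ks

  -- For a fixed first chain entry m, the condition d + i = N with i ≥ m allows in `Conv` exactly d
  -- ≤ N - m; the product allows all d ≤ N, and the surplus is `top`.
  h*Z : ∀ N ks → h N * Z N ks ≈ Conv N ks + E N ks
  h*Z N [] = begin
    h N * 1#                                ≈⟨ *-congʳ (∑<-reverse N x) ⟨
    ∑< N (λ i → x (N ∸ suc i)) * 1#         ≈⟨ ∑<-*ʳ N 1# (λ i → x (N ∸ suc i)) ⟨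
    Conv N []                               ≈⟨ +-identityʳ _ ⟨
    Conv N [] + 0#                          ∎
  h*Z N (k ∷ ks) = begin
    h N * ∑< N a                                          ≈⟨ ∑<-*ˡ N (h N) a ⟨
    ∑< N (λ i → h N * a i)                                ≈⟨ ∑<-cong N expand ⟩
    ∑< N (λ i → a i * h (N ∸ suc i) + a i * top N i)      ≈⟨ ∑<-+ N (λ i → a i * h (N ∸ suc i)) (λ i → a i * top N i) ⟩
    ∑< N (λ i → a i * h (N ∸ suc i)) + E N (k ∷ ks)       ≈⟨ +-congʳ conv ⟨
    Conv N (k ∷ ks) + E N (k ∷ ks)                        ∎
    where
    a : ℕ → Carrier
    a i = w k i * Z i ks
    expand : ∀ i → i < N → h N * a i ≈ a i * h (N ∸ suc i) + a i * top N i
    expand i i<N = trans (*-comm _ _) (trans (*-congˡ (h-top N i i<N)) (distribˡ _ _ _))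
    conv : Conv N (k ∷ ks) ≈ ∑< N (λ i → a i * h (N ∸ suc i))
    conv = begin
      ∑< N (λ i → x (N ∸ suc i) * ∑< i a)
        ≈⟨ ∑<-cong N (λ i _ → trans (sym (∑<-*ˡ i (x (N ∸ suc i)) a)) (∑<-cong i (λ j _ → *-comm (x (N ∸ suc i)) (a j)))) ⟩
      ∑< N (λ i → ∑< i (λ j → a j * x (N ∸ suc i)))
        ≈⟨ ∑<-strict-triangle N (λ i j → a j * x (N ∸ suc i)) ⟩
      ∑< N (λ j → ∑< (N ∸ suc j) (λ e → a j * x (N ∸ suc (suc j ℕ.+ e))))
        ≈⟨ ∑<-cong N (λ j _ → trans
             (∑<-*ˡ (N ∸ suc j) (a j) (λ e → x (N ∸ suc (suc j ℕ.+ e))))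
             (*-congˡ (trans
               (∑<-cong (N ∸ suc j) (λ e _ → reflexive (≡.cong x (gap j e))))
               (∑<-reverse (N ∸ suc j) x)))) ⟩
      ∑< N (λ j → a j * h (N ∸ suc j)) ∎
      where
      gap : ∀ j e → N ∸ suc (suc j ℕ.+ e) ≡ N ∸ suc j ∸ suc e
      gap j e = ≡.trans (≡.cong (N ∸_) (≡.sym (ℕ.+-suc (suc j) e))) (≡.sym (ℕ.∸-+-assoc N (suc j) (suc e)))

  -- With n = i + 1, d = e + 1 and m = n + d, these relate 1/[n], 1/[d] and 1/[m]; they carry all
  -- the arithmetic of q-integers that the truncated relation uses.
  module _
    (u-x    : ∀ i e → u e - u (suc i ℕ.+ e) ≈ x e - x (suc i ℕ.+ e))
    (x*u    : ∀ i e → x (suc i ℕ.+ e) * u e ≈ x i * (u e - u (suc i ℕ.+ e)))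
    (u*u    : ∀ i e → u i * (u e - u (suc i ℕ.+ e)) ≈ u (suc i ℕ.+ e) * x e)
    (w-pow  : ∀ κ i → w (suc κ) i ≈ x i ^ κ * u i) where

    -- A geometric sum with ratio `x i` to `x m`, evaluated without division. The case κ = 0 is
    -- `u*u`. In the step the new last term cancels the product `x m * u m`, leaving `x m * u e`,
    -- which `x*u` turns into `x i * (u e - u m)`.
    geometric : ∀ κ i e → let m = suc i ℕ.+ e in
      ∑< κ (λ j → x m ^ (κ ∸ j) * u m * (x i ^ j * u i)) ≈
      x i ^ κ * u i * (u e - u m) - x m ^ κ * u m * x e
    geometric zero    i e = begin
      0#                                                   ≈⟨ -‿inverseʳ _ ⟨
      u (suc i ℕ.+ e) * x e - u (suc i ℕ.+ e) * x e        ≈⟨ +-congʳ (u*u i e) ⟨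
      u i * (u e - u (suc i ℕ.+ e)) - u (suc i ℕ.+ e) * x e
        ≈⟨ +-cong (*-congʳ (*-identityˡ _)) (-‿cong (*-congʳ (*-identityˡ _))) ⟨
      1# * u i * (u e - u (suc i ℕ.+ e)) - 1# * u (suc i ℕ.+ e) * x e ∎
    geometric (suc κ) i e = begin
      ∑< (suc κ) (λ j → x m ^ (suc κ ∸ j) * u m * (x i ^ j * u i))
        ≈⟨ ∑<-last κ (λ j → x m ^ (suc κ ∸ j) * u m * (x i ^ j * u i)) ⟩
      ∑< κ (λ j → x m ^ (suc κ ∸ j) * u m * (x i ^ j * u i)) + x m ^ (suc κ ∸ κ) * u m * (x i ^ κ * u i)
        ≈⟨ +-cong (∑<-cong κ factor)
             (*-congʳ (*-congʳ (trans (reflexive (≡.cong (x m ^_) (ℕ.m+n∸n≡m 1 κ))) (*-identityʳ (x m))))) ⟩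
      ∑< κ (λ j → x m * (x m ^ (κ ∸ j) * u m * (x i ^ j * u i))) + x m * u m * (x i ^ κ * u i)
        ≈⟨ +-congʳ (trans (∑<-*ˡ κ (x m) (λ j → x m ^ (κ ∸ j) * u m * (x i ^ j * u i))) (*-congˡ (geometric κ i e))) ⟩
      x m * (x i ^ κ * u i * (u e - u m) - x m ^ κ * u m * x e) + x m * u m * (x i ^ κ * u i)
        ≈⟨ solve 7 (λ xm um ue ui xe y z →
             xm :* (y :* ui :* (ue :- um) :- z :* um :* xe) :+ xm :* um :* (y :* ui) :=
             y :* ui :* (xm :* ue) :- xm :* z :* um :* xe) refl (x m) (u m) (u e) (u i) (x e) (x i ^ κ) (x m ^ κ) ⟩
      x i ^ κ * u i * (x m * u e) - x m * x m ^ κ * u m * x e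
        ≈⟨ +-congʳ (*-congˡ (x*u i e)) ⟩
      x i ^ κ * u i * (x i * (u e - u m)) - x m * x m ^ κ * u m * x e
        ≈⟨ +-congʳ (solve 4 (λ y ui xi d → y :* ui :* (xi :* d) := xi :* y :* ui :* d) refl _ _ _ _) ⟩
      x i * x i ^ κ * u i * (u e - u m) - x m * x m ^ κ * u m * x e ∎
      where
      m : ℕ
      m = suc i ℕ.+ e
      factor : ∀ j → j < κ → x m ^ (suc κ ∸ j) * u m * (x i ^ j * u i) ≈ x m * (x m ^ (κ ∸ j) * u m * (x i ^ j * u i))
      factor j j<κ rewrite ℕ.+-∸-assoc 1 (ℕ.<⇒≤ j<κ) =
        solve 4 (λ a b c d → a :* b :* c :* d := a :* (b :* c :* d)) refl _ _ _ _

    -- This is `geometric` for the gap d = m - n of two chain entries, with `u-x` replacing the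
    -- difference 1/[d] - 1/[m] by one of q^d/[d] and q^m/[m], which can be summed over m.
    partial-fractions : ∀ κ i i′ → i′ < i →
      ∑< κ (λ j → w (suc κ ∸ j) i * w (j ℕ.+ 1) i′) ≈
      w (suc κ) i′ * (x (i ∸ suc i′) - x i) - w (suc κ) i * x (i ∸ suc i′)
    partial-fractions κ i i′ i′<i = begin
      ∑< κ (λ j → w (suc κ ∸ j) i * w (j ℕ.+ 1) i′)
        ≈⟨ ∑<-cong κ powers ⟩
      ∑< κ (λ j → x i ^ (κ ∸ j) * u i * (x i′ ^ j * u i′))
        ≡⟨ ≡.cong (λ m → ∑< κ (λ j → x m ^ (κ ∸ j) * u m * (x i′ ^ j * u i′))) m≡i ⟨
      ∑< κ (λ j → x m ^ (κ ∸ j) * u m * (x i′ ^ j * u i′))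
        ≈⟨ geometric κ i′ e ⟩
      x i′ ^ κ * u i′ * (u e - u m) - x m ^ κ * u m * x e
        ≈⟨ +-cong (*-cong (w-pow κ i′) (sym (u-x i′ e))) (-‿cong (*-congʳ (w-pow κ m))) ⟨
      w (suc κ) i′ * (x e - x m) - w (suc κ) m * x e
        ≡⟨ ≡.cong (λ m → w (suc κ) i′ * (x e - x m) - w (suc κ) m * x e) m≡i ⟩
      w (suc κ) i′ * (x e - x i) - w (suc κ) i * x e ∎
      where
      e m : ℕ
      e = i ∸ suc i′
      m = suc i′ ℕ.+ e
      m≡i : m ≡ i
      m≡i = ℕ.m+[n∸m]≡n i′<i
      powers : ∀ j → j < κ → w (suc κ ∸ j) i * w (j ℕ.+ 1) i′ ≈ x i ^ (κ ∸ j) * u i * (x i′ ^ j * u i′)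
      powers j j<κ rewrite ℕ.+-∸-assoc 1 (ℕ.<⇒≤ j<κ) | ℕ.+-comm j 1 = *-cong (w-pow (κ ∸ j) i) (w-pow j i′)

    tail : ℕ → ℕ → Carrier
    tail M i = ∑< (M ∸ suc i) λ e → x (suc i ℕ.+ e)

    h-tail : ∀ M i → i < M → h M ≈ h i + x i + tail M i
    h-tail M i i<M = begin
      h M                                ≡⟨ ≡.cong h (ℕ.m+[n∸m]≡n i<M) ⟨
      h (suc i ℕ.+ (M ∸ suc i))          ≈⟨ ∑<-++ (suc i) (M ∸ suc i) x ⟩
      h (suc i) + tail M i               ≈⟨ +-congʳ (∑<-last i x) ⟩
      h i + x i + tail M i               ∎

    -- Of the two parts of the partial fractions, the first involves the larger entry m only through
    -- x(m-n) - x(m), so summing over m up to M leaves differences of partial sums of `x`. The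
    -- second, summed over the smaller entry n, is a convolution.
    split-Z : ∀ M κ ks → let k = suc κ in split (Z M) k ks ≈
      ∑< M (λ i → w k i * Z i ks * (h (M ∸ suc i) - tail M i) - w k i * Conv i ks)
    split-Z M κ ks = begin
      ∑< κ (λ j → ∑< M (λ i → w (k ∸ j) i * ∑< i (λ i′ → w (j ℕ.+ 1) i′ * z i′)))
        ≈⟨ ∑<-comm κ M (λ j i → w (k ∸ j) i * ∑< i (λ i′ → w (j ℕ.+ 1) i′ * z i′)) ⟩
      ∑< M (λ i → ∑< κ (λ j → w (k ∸ j) i * ∑< i (λ i′ → w (j ℕ.+ 1) i′ * z i′)))
        ≈⟨ ∑<-cong M (λ i _ → inner i) ⟩
      ∑< M (λ i → ∑< i (p i) + - (w k i * Conv i ks))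
        ≈⟨ ∑<-+ M (λ i → ∑< i (p i)) (λ i → - (w k i * Conv i ks)) ⟩
      ∑< M (λ i → ∑< i (p i)) + ∑< M (λ i → - (w k i * Conv i ks))
        ≈⟨ +-congʳ (∑<-strict-triangle M p) ⟩
      ∑< M (λ j → ∑< (M ∸ suc j) (λ e → p (suc j ℕ.+ e) j)) + ∑< M (λ i → - (w k i * Conv i ks))
        ≈⟨ +-congʳ (∑<-cong M (λ j _ → outer j)) ⟩
      ∑< M (λ i → w k i * z i * (h (M ∸ suc i) - tail M i)) + ∑< M (λ i → - (w k i * Conv i ks))
        ≈⟨ ∑<-+ M (λ i → w k i * z i * (h (M ∸ suc i) - tail M i)) (λ i → - (w k i * Conv i ks)) ⟨
      ∑< M (λ i → w k i * z i * (h (M ∸ suc i) - tail M i) - w k i * Conv i ks) ∎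
      where
      k : ℕ
      k = suc κ
      z : ℕ → Carrier
      z i = Z i ks
      p : ℕ → ℕ → Carrier
      p i i′ = w k i′ * z i′ * (x (i ∸ suc i′) - x i)
      inner : ∀ i → ∑< κ (λ j → w (k ∸ j) i * ∑< i (λ i′ → w (j ℕ.+ 1) i′ * z i′)) ≈
                    ∑< i (p i) + - (w k i * Conv i ks)
      inner i = begin
        ∑< κ (λ j → w (k ∸ j) i * ∑< i (λ i′ → w (j ℕ.+ 1) i′ * z i′))
          ≈⟨ ∑<-cong κ (λ j _ → sym (∑<-*ˡ i (w (k ∸ j) i) (λ i′ → w (j ℕ.+ 1) i′ * z i′))) ⟩
        ∑< κ (λ j → ∑< i (λ i′ → w (k ∸ j) i * (w (j ℕ.+ 1) i′ * z i′)))
          ≈⟨ ∑<-comm κ i (λ j i′ → w (k ∸ j) i * (w (j ℕ.+ 1) i′ * z i′)) ⟩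
        ∑< i (λ i′ → ∑< κ (λ j → w (k ∸ j) i * (w (j ℕ.+ 1) i′ * z i′)))
          ≈⟨ ∑<-cong i term ⟩
        ∑< i (λ i′ → p i i′ + - w k i * (x (i ∸ suc i′) * z i′))
          ≈⟨ ∑<-+ i (p i) (λ i′ → - w k i * (x (i ∸ suc i′) * z i′)) ⟩
        ∑< i (p i) + ∑< i (λ i′ → - w k i * (x (i ∸ suc i′) * z i′))
          ≈⟨ +-congˡ (trans (∑<-*ˡ i (- w k i) (λ i′ → x (i ∸ suc i′) * z i′)) (solve 2 (λ a b → :- a :* b := :- (a :* b)) refl _ _)) ⟩
        ∑< i (p i) + - (w k i * Conv i ks) ∎
        where
        term : ∀ i′ → i′ < i → ∑< κ (λ j → w (k ∸ j) i * (w (j ℕ.+ 1) i′ * z i′)) ≈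
                               p i i′ + - w k i * (x (i ∸ suc i′) * z i′)
        term i′ i′<i = begin
          ∑< κ (λ j → w (k ∸ j) i * (w (j ℕ.+ 1) i′ * z i′))
            ≈⟨ ∑<-cong κ (λ j _ → sym (*-assoc (w (k ∸ j) i) (w (j ℕ.+ 1) i′) (z i′))) ⟩
          ∑< κ (λ j → w (k ∸ j) i * w (j ℕ.+ 1) i′ * z i′)
            ≈⟨ ∑<-*ʳ κ (z i′) (λ j → w (k ∸ j) i * w (j ℕ.+ 1) i′) ⟩
          ∑< κ (λ j → w (k ∸ j) i * w (j ℕ.+ 1) i′) * z i′
            ≈⟨ *-congʳ (partial-fractions κ i i′ i′<i) ⟩
          (w k i′ * (x (i ∸ suc i′) - x i) - w k i * x (i ∸ suc i′)) * z i′
            ≈⟨ solve 5 (λ a b c d z → (a :* (b :- c) :- d :* b) :* z := a :* z :* (b :- c) :+ (:- d) :* (b :* z)) refl _ _ _ _ _ ⟩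
          p i i′ + - w k i * (x (i ∸ suc i′) * z i′) ∎
      outer : ∀ j → ∑< (M ∸ suc j) (λ e → p (suc j ℕ.+ e) j) ≈ w k j * z j * (h (M ∸ suc j) - tail M j)
      outer j = begin
        ∑< r (λ e → w k j * z j * (x (j ℕ.+ e ∸ j) - x (suc j ℕ.+ e)))
          ≈⟨ ∑<-*ˡ r (w k j * z j) (λ e → x (j ℕ.+ e ∸ j) - x (suc j ℕ.+ e)) ⟩
        w k j * z j * ∑< r (λ e → x (j ℕ.+ e ∸ j) - x (suc j ℕ.+ e))
          ≈⟨ *-congˡ (∑<-cong r (λ e _ → +-cong (reflexive (≡.cong x (ℕ.m+n∸m≡n j e))) (sym (-1*x≈-x (x (suc j ℕ.+ e)))))) ⟩
        w k j * z j * ∑< r (λ e → x e + - 1# * x (suc j ℕ.+ e))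
          ≈⟨ *-congˡ (trans (∑<-+ r x (λ e → - 1# * x (suc j ℕ.+ e)))
               (+-congˡ (trans (∑<-*ˡ r (- 1#) (λ e → x (suc j ℕ.+ e))) (-1*x≈-x _)))) ⟩
        w k j * z j * (h r - tail M j) ∎
        where
        open RingProperties ring using (-1*x≈-x)
        r : ℕ
        r = M ∸ suc j

    -- The exact error belongs to the statement because the induction meets the tail at every
    -- cut-off below M, where its error need not be negligible.
    truncated-hoffman : ∀ M ks → All (1 ≤_) ks → D split (Z M) ks + E M ks ≈ D raise (Z M) ks
    truncated-hoffman M []       []           = +-identityˡ 0#
    truncated-hoffman M (k@(suc κ) ∷ ks) (_ ∷ 1≤ks) = begin
      split (Z M) k ks + D split (λ 𝐩 → Z M (k ∷ 𝐩)) ks + E M (k ∷ ks)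
        ≈⟨ +-congʳ (+-cong (split-Z M κ ks) (D-Z split-linear)) ⟩
      ∑< M f + ∑< M (λ i → w k i * D split (Z i) ks) + E M (k ∷ ks)
        ≈⟨ trans (∑<-+ M (λ i → f i + w k i * D split (Z i) ks) (λ i → w k i * Z i ks * top M i))
             (+-congʳ (∑<-+ M f (λ i → w k i * D split (Z i) ks))) ⟨
      ∑< M (λ i → f i + w k i * D split (Z i) ks + w k i * Z i ks * top M i)
        ≈⟨ ∑<-cong M term ⟩
      ∑< M (λ i → w (k ℕ.+ 1) i * Z i ks + w k i * D raise (Z i) ks)
        ≈⟨ ∑<-+ M (λ i → w (k ℕ.+ 1) i * Z i ks) (λ i → w k i * D raise (Z i) ks) ⟩
      raise (Z M) k ks + ∑< M (λ i → w k i * D raise (Z i) ks)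
        ≈⟨ +-congˡ (D-Z raise-linear) ⟨
      raise (Z M) k ks + D raise (λ 𝐩 → Z M (k ∷ 𝐩)) ks ∎
      where
      f : ℕ → Carrier
      f i = w k i * Z i ks * (h (M ∸ suc i) - tail M i) - w k i * Conv i ks
      D-Z : ∀ {φ} → IsLinear φ → D φ (λ 𝐩 → Z M (k ∷ 𝐩)) ks ≈ ∑< M (λ i → w k i * D φ (Z i) ks)
      D-Z {φ} φ-linear = trans
        (D-∑ φ-linear M (λ i 𝐩 → w k i * Z i 𝐩) ks 1≤ks)
        (∑<-cong M (λ i _ → D-*ˡ φ-linear (w k i) (Z i) ks))
      term : ∀ i → i < M →
        f i + w k i * D split (Z i) ks + w k i * Z i ks * top M i ≈
        w (k ℕ.+ 1) i * Z i ks + w k i * D raise (Z i) ks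
      term i i<M = begin
        W * z * (h⁻ - T) - W * C + W * s + W * z * top M i
          -- Adding and subtracting `E i ks` completes the convolution to `h i * z` and, by
          -- induction, the split tail to the raised tail. The outer error completes `h⁻` to `h M`;
          -- then only `x i` remains of the harmonic sums, and multiplying by it raises `k` by one.
          ≈⟨ solve 8 (λ W z h⁻ T C s τ E →
               W :* z :* (h⁻ :- T) :- W :* C :+ W :* s :+ W :* z :* τ :=
               W :* z :* (h⁻ :+ τ :- T) :- W :* (C :+ E) :+ W :* (s :+ E))
             refl W z h⁻ T C s (top M i) (E i ks) ⟩
        W * z * (h⁻ + top M i - T) - W * (C + E i ks) + W * (s + E i ks)
          ≈⟨ +-cong (+-cong (*-congˡ (+-congʳ (sym (h-top M i i<M)))) (-‿cong (*-congˡ (sym (h*Z i ks)))))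
                    (*-congˡ (truncated-hoffman i ks 1≤ks)) ⟩
        W * z * (h M - T) - W * (h i * z) + W * r
          ≈⟨ +-congʳ (+-congʳ (*-congˡ (+-congʳ (h-tail M i i<M)))) ⟩
        W * z * (h i + x i + T - T) - W * (h i * z) + W * r
          ≈⟨ solve 6 (λ W z r T hi xi →
               W :* z :* (hi :+ xi :+ T :- T) :- W :* (hi :* z) :+ W :* r := xi :* W :* z :+ W :* r)
             refl W z r T (h i) (x i) ⟩
        x i * W * z + W * r
          ≈⟨ +-congʳ (*-congʳ (trans (w-pow k i) (trans (*-assoc _ _ _) (*-congˡ (sym (w-pow κ i)))))) ⟨
        w (suc k) i * z + W * r
          ≡⟨ ≡.cong (λ n → w n i * z + W * r) (ℕ.+-comm 1 k) ⟩
        w (k ℕ.+ 1) i * z + W * r ∎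
        where
        W z h⁻ T C s r : Carrier
        W = w k i
        z = Z i ks
        h⁻ = h (M ∸ suc i)
        T = tail M i
        C = Conv i ks
        s = D split (Z i) ks
        r = D raise (Z i) ks

-- Reciprocals of q-integers.

module QIntegers {c ℓ} (R : CommutativeRing c ℓ) where
  open CommutativeRing R hiding (_-_)
  open RingNotation rawRing using (_^_; _-_)
  open Exp commutativeSemiring using (^-homo-*; ^-assocʳ; ^-distrib-*; ^-congˡ)
  open IntegerSolver R
  open SetoidReasoning setoid

  -- v is the inverse of 1 - q, and u i that of the q-integer [i + 1].
  module Inverses (q v : Carrier) (u : ℕ → Carrier)
                  (1-q*v : (1# - q) * v ≈ 1#)
                  (u-inverse : ∀ i → (1# - q ^ suc i) * v * u i ≈ 1#) where

    x : ℕ → Carrier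
    x i = q ^ suc i * u i

    private
      q^-+ : ∀ i e → q ^ suc (suc i ℕ.+ e) ≈ q ^ suc i * q ^ suc e
      q^-+ i e = trans (reflexive (≡.cong (q ^_) (≡.sym (ℕ.+-suc (suc i) e)))) (^-homo-* q (suc i) (suc e))

      -- The q-integer [i + e + 2] is q^(e + 1) [i + 1] + [e + 1].
      u*u+ : ∀ i e → u i * u e ≈ u (suc i ℕ.+ e) * x e + u i * u (suc i ℕ.+ e)
      u*u+ i e = begin
        u i * u e
          ≈⟨ *-identityˡ _ ⟨
        1# * (u i * u e)
          ≈⟨ *-congʳ (u-inverse m) ⟨
        (1# - q ^ suc m) * v * u m * (u i * u e)
          ≈⟨ *-congʳ (*-congʳ (*-congʳ (+-congˡ (-‿cong (q^-+ i e))))) ⟩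
        (1# - qⁿ * qᵈ) * v * u m * (u i * u e)
          ≈⟨ solve 7 (λ o n d v um ui ue →
               (o :- n :* d) :* v :* um :* (ui :* ue) :=
               d :* ((o :- n) :* v :* ui) :* um :* ue :+ (o :- d :* o) :* v :* ue :* um :* ui)
             refl 1# qⁿ qᵈ v (u m) (u i) (u e) ⟩
        qᵈ * ((1# - qⁿ) * v * u i) * u m * u e + (1# - qᵈ * 1#) * v * u e * u m * u i
          ≈⟨ +-cong (*-congʳ (*-congʳ (*-congˡ (u-inverse i))))
                    (*-congʳ (*-congʳ (trans (*-congʳ (*-congʳ (+-congˡ (-‿cong (*-identityʳ _))))) (u-inverse e)))) ⟩
        qᵈ * 1# * u m * u e + 1# * u m * u i
          ≈⟨ solve 4 (λ d um ue ui → d :* con (+ 1) :* um :* ue :+ con (+ 1) :* um :* ui := um :* (d :* ue) :+ ui :* um)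
             refl qᵈ (u m) (u e) (u i) ⟩
        u m * x e + u i * u m ∎
        where
        m : ℕ
        m = suc i ℕ.+ e
        qⁿ qᵈ : Carrier
        qⁿ = q ^ suc i
        qᵈ = q ^ suc e

      -- Since 1 - q^m = (1-q) [m], the difference of 1/[m] and q^m/[m] does not depend on m, so it
      -- cancels in `u-x`.
      u-offset : ∀ i → u i ≈ x i + (1# - q)
      u-offset i = begin
        u i
          ≈⟨ solve 3 (λ p u o → u := p :* u :+ (con (+ 1) :- p) :* con (+ 1) :* u) refl (q ^ suc i) (u i) 1# ⟩
        x i + (1# - q ^ suc i) * 1# * u i
          ≈⟨ +-congˡ (*-congʳ (*-congˡ 1-q*v)) ⟨
        x i + (1# - q ^ suc i) * ((1# - q) * v) * u i
          ≈⟨ +-congˡ (solve 4 (λ a b v u → a :* (b :* v) :* u := b :* (a :* v :* u)) refl _ _ _ _) ⟩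
        x i + (1# - q) * ((1# - q ^ suc i) * v * u i)
          ≈⟨ +-congˡ (trans (*-congˡ (u-inverse i)) (*-identityʳ _)) ⟩
        x i + (1# - q) ∎

    u*u : ∀ i e → u i * (u e - u (suc i ℕ.+ e)) ≈ u (suc i ℕ.+ e) * x e
    u*u i e = begin
      u i * (u e - u m)                    ≈⟨ solve 3 (λ a b c → a :* (b :- c) := a :* b :- a :* c) refl _ _ _ ⟩
      u i * u e - u i * u m                ≈⟨ +-congʳ (u*u+ i e) ⟩
      u m * x e + u i * u m - u i * u m    ≈⟨ solve 2 (λ a b → a :+ b :- b := a) refl _ _ ⟩
      u m * x e                            ∎
      where
      m : ℕ
      m = suc i ℕ.+ e

    -- This is `u*u` multiplied by q^n, with q^(n+d) factored as q^n q^d.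
    x*u : ∀ i e → x (suc i ℕ.+ e) * u e ≈ x i * (u e - u (suc i ℕ.+ e))
    x*u i e = begin
      q ^ suc m * u m * u e                ≈⟨ *-congʳ (*-congʳ (q^-+ i e)) ⟩
      q ^ suc i * q ^ suc e * u m * u e    ≈⟨ solve 4 (λ a b c d → a :* b :* c :* d := a :* (c :* (b :* d))) refl _ _ _ _ ⟩
      q ^ suc i * (u m * x e)              ≈⟨ *-congˡ (u*u i e) ⟨
      q ^ suc i * (u i * (u e - u m))      ≈⟨ *-assoc _ _ _ ⟨
      x i * (u e - u m)                    ∎
      where
      m : ℕ
      m = suc i ℕ.+ e

    u-x : ∀ i e → u e - u (suc i ℕ.+ e) ≈ x e - x (suc i ℕ.+ e)
    u-x i e = trans
      (+-cong (u-offset e) (-‿cong (u-offset (suc i ℕ.+ e))))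
      (solve 3 (λ a b c → a :+ c :- (b :+ c) := a :- b) refl _ _ _)

    -- The summand of ζq contains the inverse of a power where `x` and `u` give a power of the
    -- inverse; uniqueness of inverses identifies `g` with the latter.
    power-quotient : ∀ κ i g → ((1# - q ^ suc i) * v) ^ suc κ * g ≈ 1# → q ^ (κ ℕ.* suc i) * g ≈ x i ^ κ * u i
    power-quotient κ i g inverse = begin
      q ^ (κ ℕ.* suc i) * g
        ≈⟨ *-cong (trans (reflexive (≡.cong (q ^_) (ℕ.*-comm κ (suc i)))) (sym (^-assocʳ q (suc i) κ))) g≈ ⟩
      (q ^ suc i) ^ κ * (u i * u i ^ κ)
        ≈⟨ solve 3 (λ a b c → a :* (b :* c) := a :* c :* b) refl _ _ _ ⟩
      (q ^ suc i) ^ κ * u i ^ κ * u i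
        ≈⟨ *-congʳ (^-distrib-* (q ^ suc i) (u i) κ) ⟨
      x i ^ κ * u i ∎
      where
      b : Carrier
      b = (1# - q ^ suc i) * v
      1^ : ∀ n → 1# ^ n ≈ 1#
      1^ zero    = refl
      1^ (suc n) = trans (*-identityˡ _) (1^ n)
      g≈ : g ≈ u i ^ suc κ
      g≈ = begin
        g                                ≈⟨ *-identityˡ g ⟨
        1# * g                           ≈⟨ *-congʳ (1^ (suc κ)) ⟨
        1# ^ suc κ * g                   ≈⟨ *-congʳ (^-congˡ (suc κ) (u-inverse i)) ⟨
        (b * u i) ^ suc κ * g            ≈⟨ *-congʳ (^-distrib-* b (u i) (suc κ)) ⟩
        b ^ suc κ * u i ^ suc κ * g      ≈⟨ solve 3 (λ a b c → a :* b :* c := a :* c :* b) refl _ _ _ ⟩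
        b ^ suc κ * g * u i ^ suc κ      ≈⟨ *-congʳ inverse ⟩
        1# * u i ^ suc κ                 ≈⟨ *-identityˡ _ ⟩
        u i ^ suc κ                      ∎

-- Divisibility of power series by powers of the variable.

module SeriesOrder {c ℓ} (R : CommutativeRing c ℓ) where
  private
    module R = CommutativeRing R
    open FiniteSums R using (∑<-zero)
    P : CommutativeRing c ℓ
    P = SeriesRing.commutativeRing R
  open CommutativeRing P
  open RingNotation rawRing using (_^_)
  private module P = FiniteSums P

  Order≥ : ℕ → Carrier → Set ℓ
  Order≥ d f = ∀ n → n < d → f n R.≈ R.0#

  order-weaken : ∀ {a b} f → b ≤ a → Order≥ a f → Order≥ b f
  order-weaken f b≤a f≥a n n<b = f≥a n (ℕ.<-≤-trans n<b b≤a)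

  -- In degree n < a + b, each product of coefficients of degrees i and n - i has i < a or n - i <
  -- b.
  order-* : ∀ {a b} f g → Order≥ a f → Order≥ b g → Order≥ (a ℕ.+ b) (f * g)
  order-* {a} {b} f g f≥a g≥b n n<a+b = ∑<-zero (suc n) vanish
    where
    vanish : ∀ i → i < suc n → f i R.* g (n ∸ i) R.≈ R.0#
    vanish i (s≤s i≤n) with ℕ.<-≤-connex i a
    ... | inj₁ i<a = R.trans (R.*-congʳ (f≥a i i<a)) (R.zeroˡ _)
    ... | inj₂ a≤i = R.trans (R.*-congˡ (g≥b (n ∸ i) n∸i<b)) (R.zeroʳ _)
      where
      n∸i<b : n ∸ i < b
      n∸i<b = ℕ.≤-<-trans (ℕ.∸-monoʳ-≤ n a≤i)
        (≡.subst (suc (n ∸ a) ≤_) (ℕ.m+n∸m≡n a b)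
          (ℕ.∸-monoˡ-< n<a+b (ℕ.≤-trans a≤i i≤n)))

  order-*ˡ : ∀ {a} f g → Order≥ a f → Order≥ a (f * g)
  order-*ˡ {a} f g f≥a = order-weaken (f * g) (ℕ.m≤m+n a 0) (order-* f g f≥a λ _ ())

  order-∑ : ∀ {d} n f → (∀ i → i < n → Order≥ d (f i)) → Order≥ d (P.∑< n f)
  order-∑ zero    f f≥d m m<d = R.refl
  order-∑ (suc n) f f≥d m m<d = R.trans
    (R.+-cong (f≥d 0 ℕ.z<s m m<d) (order-∑ n (λ i → f (suc i)) (λ i i<n → f≥d (suc i) (ℕ.s<s i<n)) m m<d))
    (R.+-identityˡ R.0#)

  order-X^ : ∀ d → Order≥ d (PowerSeries.X R.rawRing ^ d)
  order-X^ zero    n ()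
  order-X^ (suc d) = order-* (PowerSeries.X R.rawRing) (PowerSeries.X R.rawRing ^ d) X≥1 (order-X^ d)
    where
    X≥1 : Order≥ 1 (PowerSeries.X R.rawRing)
    X≥1 zero    _           = R.refl
    X≥1 (suc n) (s≤s ())

-- Transport of splitting and raising along additive maps.

module AdditiveMap {c₁ ℓ₁ c₂ ℓ₂} (A : CommutativeRing c₁ ℓ₁) (B : CommutativeRing c₂ ℓ₂)
  (ψ : CommutativeRing.Carrier A → CommutativeRing.Carrier B) where
  private
    module From where
      open CommutativeRing A public
      open FiniteSums A public
      open IndexOperators A public
    module To where
      open CommutativeRing B public
      open FiniteSums B public
      open IndexOperators B public

  module _ (ψ-0 : ψ From.0# To.≈ To.0#) (ψ-+ : ∀ x y → ψ (x From.+ y) To.≈ ψ x To.+ ψ y) where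

    ψ-∑ : ∀ n f → ψ (From.∑< n f) To.≈ To.∑< n (λ i → ψ (f i))
    ψ-∑ zero    f = ψ-0
    ψ-∑ (suc n) f = To.trans (ψ-+ _ _) (To.+-congˡ (ψ-∑ n (λ i → f (suc i))))

    -- Assumes additivity alone because one of the two applications is the coefficient map f ↦ f n,
    -- which is not multiplicative; the other is the embedding `C` of constants.
    D-split : ∀ G ks → ψ (From.D From.split G ks) To.≈ To.D To.split (λ 𝐩 → ψ (G 𝐩)) ks
    D-split G []       = ψ-0
    D-split G (k ∷ ks) = To.trans (ψ-+ _ _)
      (To.+-cong (ψ-∑ (k ∸ 1) (λ j → G (k ∸ j ∷ j ℕ.+ 1 ∷ ks))) (D-split (λ 𝐩 → G (k ∷ 𝐩)) ks))

    D-raise : ∀ G ks → ψ (From.D From.raise G ks) To.≈ To.D To.raise (λ 𝐩 → ψ (G 𝐩)) ks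
    D-raise G []       = ψ-0
    D-raise G (k ∷ ks) = To.trans (ψ-+ _ _) (To.+-congˡ (D-raise (λ 𝐩 → G (k ∷ 𝐩)) ks))

-- From lists of fillings and sums over positions to `S` and `D`.

module Fillings {c ℓ} (R : CommutativeRing c ℓ) (t ħ : CommutativeRing.Carrier R) where
  open CommutativeRing R hiding (_-_)
  open RingNotation rawRing using (_^_; _×_; _-_; sumList; ∑-syntax)
  open FiniteSums R
  open IndexOperators R
  open Interpolation R t ħ
  open IntegerSolver R
  open SetoidReasoning setoid

  sumList-++ : ∀ xs ys → sumList (xs ++ ys) ≈ sumList xs + sumList ys
  sumList-++ []       ys = sym (+-identityˡ _)
  sumList-++ (x ∷ xs) ys = trans (+-congˡ (sumList-++ xs ys)) (sym (+-assoc _ _ _))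

  weight : ℕ → ℕ → (List ℕ → Carrier) → List ℕ → Carrier
  weight W L F 𝐩 = ħ ^ (W ∸ wt 𝐩) * F 𝐩 * t ^ (L ∸ dep 𝐩)

  -- The reference weight and depth must vary: a comma removes `k` from `W` and one from `L`, while
  -- merging keeps both and shortens the index. The depth lost yields a factor `t`, and the unit of
  -- weight lost by "-1+" yields a factor `ħ`.
  fillings-sum : ∀ W L F k ks → 1 ≤ k → All (1 ≤_) ks → wt (k ∷ ks) ≤ W → dep (k ∷ ks) ≤ L →
    sumList (map (weight W L F) (fillings k ks)) ≈
    ħ ^ (W ∸ wt (k ∷ ks)) * t ^ (L ∸ dep (k ∷ ks)) * S′ F k ks
  fillings-sum W L F k [] 1≤k [] wt≤W dep≤L =
    solve 3 (λ a b c → a :* b :* c :+ con (+ 0) := a :* c :* b) refl _ _ _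
  fillings-sum W (suc L) F k (k′ ∷ ks) 1≤k (1≤k′ ∷ 1≤ks) wt≤W (s≤s dep≤L) = begin
    sumList (map (weight W (suc L) F) (map (k ∷_) φ₀ ++ φ₁ ++ φ₂))
      ≡⟨ ≡.cong sumList (≡.trans (List.map-++ (weight W (suc L) F) (map (k ∷_) φ₀) (φ₁ ++ φ₂))
           (≡.cong₂ _++_ prefix (List.map-++ (weight W (suc L) F) φ₁ φ₂))) ⟩
    sumList (map (weight (W ∸ k) L (λ 𝐩 → F (k ∷ 𝐩))) φ₀ ++ map (weight W (suc L) F) φ₁ ++ map (weight W (suc L) F) φ₂)
      ≈⟨ trans (sumList-++ (map (weight (W ∸ k) L (λ 𝐩 → F (k ∷ 𝐩))) φ₀) _)
           (+-congˡ (sumList-++ (map (weight W (suc L) F) φ₁) _)) ⟩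
    sumList (map (weight (W ∸ k) L (λ 𝐩 → F (k ∷ 𝐩))) φ₀) +
      (sumList (map (weight W (suc L) F) φ₁) + sumList (map (weight W (suc L) F) φ₂))
      ≈⟨ +-cong (fillings-sum (W ∸ k) L (λ 𝐩 → F (k ∷ 𝐩)) k′ ks 1≤k′ 1≤ks wt₀ dep≤L)
           (+-cong
             (fillings-sum W (suc L) F (k ℕ.+ k′) ks (ℕ.≤-trans 1≤k (ℕ.m≤m+n k k′)) 1≤ks wt₁ (ℕ.m≤n⇒m≤1+n dep≤L))
             (fillings-sum W (suc L) F (k ℕ.+ k′ ∸ 1) ks 1≤k+k′∸1 1≤ks wt₂ (ℕ.m≤n⇒m≤1+n dep≤L))) ⟩
    ħ ^ (W ∸ k ∸ wt (k′ ∷ ks)) * t ^ (L ∸ dep (k′ ∷ ks)) * s₀ +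
      (ħ ^ (W ∸ wt (k ℕ.+ k′ ∷ ks)) * t ^ (suc L ∸ dep (k′ ∷ ks)) * s₁ +
       ħ ^ (W ∸ wt (k ℕ.+ k′ ∸ 1 ∷ ks)) * t ^ (suc L ∸ dep (k′ ∷ ks)) * s₂)
      ≡⟨ ≡.cong₂ (λ a d → ħ ^ a * t ^ (L ∸ dep (k′ ∷ ks)) * s₀ + d)
           (ℕ.∸-+-assoc W k (wt (k′ ∷ ks)))
           (≡.cong₂ (λ b c → ħ ^ b * t ^ (suc L ∸ dep (k′ ∷ ks)) * s₁ + ħ ^ c * t ^ (suc L ∸ dep (k′ ∷ ks)) * s₂)
              (≡.cong (W ∸_) (ℕ.+-assoc k k′ (wt ks))) exponent₂) ⟩
    ħ ^ e * t ^ d * s₀ + (ħ ^ e * t ^ (suc L ∸ dep (k′ ∷ ks)) * s₁ + ħ ^ suc e * t ^ (suc L ∸ dep (k′ ∷ ks)) * s₂)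
      ≡⟨ ≡.cong (λ f → ħ ^ e * t ^ d * s₀ + (ħ ^ e * t ^ f * s₁ + ħ ^ suc e * t ^ f * s₂)) (ℕ.+-∸-assoc 1 dep≤L) ⟩
    ħ ^ e * t ^ d * s₀ + (ħ ^ e * t ^ suc d * s₁ + ħ ^ suc e * t ^ suc d * s₂)
      ≈⟨ solve 7 (λ t ħ a b s₀ s₁ s₂ →
           a :* b :* s₀ :+ (a :* (t :* b) :* s₁ :+ ħ :* a :* (t :* b) :* s₂) :=
           a :* b :* (s₀ :+ t :* s₁ :+ ħ :* t :* s₂)) refl t ħ (ħ ^ e) (t ^ d) s₀ s₁ s₂ ⟩
    ħ ^ e * t ^ d * S′ F k (k′ ∷ ks) ∎
    where
    φ₀ φ₁ φ₂ : List (List ℕ)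
    φ₀ = fillings k′ ks
    φ₁ = fillings (k ℕ.+ k′) ks
    φ₂ = fillings (k ℕ.+ k′ ∸ 1) ks
    s₀ s₁ s₂ : Carrier
    s₀ = S′ (λ 𝐩 → F (k ∷ 𝐩)) k′ ks
    s₁ = S′ F (k ℕ.+ k′) ks
    s₂ = S′ F (k ℕ.+ k′ ∸ 1) ks
    e d : ℕ
    e = W ∸ wt (k ∷ k′ ∷ ks)
    d = L ∸ dep (k′ ∷ ks)
    prefix : map (weight W (suc L) F) (map (k ∷_) φ₀) ≡ map (weight (W ∸ k) L (λ 𝐩 → F (k ∷ 𝐩))) φ₀
    prefix = ≡.trans (≡.sym (List.map-∘ φ₀)) (List.map-cong
      (λ 𝐩 → ≡.cong (λ n → ħ ^ n * F (k ∷ 𝐩) * t ^ (L ∸ dep 𝐩)) (≡.sym (ℕ.∸-+-assoc W k (wt 𝐩)))) φ₀)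
    1≤k+k′∸1 : 1 ≤ k ℕ.+ k′ ∸ 1
    1≤k+k′∸1 = ≡.subst (1 ≤_) (≡.sym (ℕ.+-∸-assoc k 1≤k′)) (ℕ.≤-trans 1≤k (ℕ.m≤m+n k (k′ ∸ 1)))
    wt₀ : wt (k′ ∷ ks) ≤ W ∸ k
    wt₀ = ≡.subst (_≤ W ∸ k) (ℕ.m+n∸m≡n k (wt (k′ ∷ ks))) (ℕ.∸-monoˡ-≤ k wt≤W)
    wt₁ : wt (k ℕ.+ k′ ∷ ks) ≤ W
    wt₁ = ≡.subst (_≤ W) (≡.sym (ℕ.+-assoc k k′ (wt ks))) wt≤W
    suc-wt₂ : suc (wt (k ℕ.+ k′ ∸ 1 ∷ ks)) ≡ wt (k ∷ k′ ∷ ks)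
    suc-wt₂ = ≡.trans (≡.cong (ℕ._+ wt ks) (ℕ.m+[n∸m]≡n {1} (ℕ.≤-trans 1≤k (ℕ.m≤m+n k k′)))) (ℕ.+-assoc k k′ (wt ks))
    wt₂ : wt (k ℕ.+ k′ ∸ 1 ∷ ks) ≤ W
    wt₂ = ℕ.≤-trans (ℕ.n≤1+n _) (≡.subst (_≤ W) (≡.sym suc-wt₂) wt≤W)
    exponent₂ : W ∸ wt (k ℕ.+ k′ ∸ 1 ∷ ks) ≡ suc e
    exponent₂ = ≡.trans (≡.cong (suc W ∸_) suc-wt₂) (ℕ.+-∸-assoc 1 wt≤W)

  -- The two sides of the theorem, copied for an arbitrary `G`, so that an induction on the index
  -- can pass to `G` behind the first entry.
  splitSum rhsSum : (List ℕ → Carrier) → ℕ → List ℕ → Carrier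
  splitSum G k₁ ks =
    let 𝐤 = k₁ ∷ ks
        k = lookup 𝐤
    in ∑[ i < length 𝐤 ] ∑[ j < k i ∸ 1 ]
         G (take (toℕ i) 𝐤 ++ (k i ∸ toℕ j) ∷ (toℕ j ℕ.+ 1) ∷ drop (suc (toℕ i)) 𝐤)
  rhsSum G k₁ ks =
    let 𝐤 = k₁ ∷ ks
        l = length 𝐤
        k = lookup 𝐤
    in
    (∑[ i < l ]
        (1# + (k i × 1# - 2 × 1# + δ (suc (toℕ i)) l × 1#) * t)
          * G (take (toℕ i) 𝐤 ++ (k i ℕ.+ 1) ∷ drop (suc (toℕ i)) 𝐤))
    + t * (t - 1#)
        * (∑[ i < l ∸ 1 ]
            G (take (toℕ i) 𝐤 ++ (k (inject₁ i) ℕ.+ k (suc i) ℕ.+ 1) ∷ drop (2 ℕ.+ toℕ i) 𝐤))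
    + ħ
        * ( (∑[ i < l ] t * (k i × 1# - 1#) * G 𝐤)
          + t * (t - 1#)
              * (∑[ i < l ∸ 1 ]
                  G (take (toℕ i) 𝐤 ++ (k (inject₁ i) ℕ.+ k (suc i)) ∷ drop (2 ℕ.+ toℕ i) 𝐤)))

  splitSum≈D : ∀ G k ks → splitSum G k ks ≈ D split G (k ∷ ks)
  splitSum≈D G k []        = refl
  splitSum≈D G k (k′ ∷ ks) = +-congˡ (splitSum≈D (λ 𝐩 → G (k ∷ 𝐩)) k′ ks)

  -- Every sum sheds its first position by reduction: `δ (suc (suc i)) (suc l)` reduces to
  -- `δ (suc i) l`, and `take` beyond position 0 to a prefix `k`. Only regrouping remains.
  rhsSum≈D : ∀ G k ks → rhsSum G k ks ≈ D rhs G (k ∷ ks)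
  rhsSum≈D G k [] = solve 5 (λ t ħ r b m →
    r :+ con (+ 0) :+ t :* b :* con (+ 0) :+ ħ :* (m :+ con (+ 0) :+ t :* b :* con (+ 0)) := r :+ ħ :* m :+ con (+ 0))
    refl t ħ _ _ _
  rhsSum≈D G k (k′ ∷ ks) = trans
    (solve 10 (λ s ħ r r′ b b′ m m′ c c′ →
      (r :+ r′) :+ s :* (b :+ b′) :+ ħ :* ((m :+ m′) :+ s :* (c :+ c′)) :=
      (r :+ s :* b :+ ħ :* (m :+ s :* c)) :+ (r′ :+ s :* b′ :+ ħ :* (m′ :+ s :* c′)))
      refl (t * (t - 1#)) ħ _ _ _ _ _ _ _ _)
    (+-congˡ (rhsSum≈D (λ 𝐩 → G (k ∷ 𝐩)) k′ ks))

  weighted-fillings : ∀ F k ks → All (1 ≤_) (k ∷ ks) →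
    sumList (map (weight (wt (k ∷ ks)) (dep (k ∷ ks)) F) (fillings k ks)) ≈ S F (k ∷ ks)
  weighted-fillings F k ks (1≤k ∷ 1≤ks) = begin
    sumList (map (weight (wt 𝐤) (dep 𝐤) F) (fillings k ks))
      ≈⟨ fillings-sum (wt 𝐤) (dep 𝐤) F k ks 1≤k 1≤ks ℕ.≤-refl ℕ.≤-refl ⟩
    ħ ^ (wt 𝐤 ∸ wt 𝐤) * t ^ (dep 𝐤 ∸ dep 𝐤) * S F 𝐤
      ≡⟨ ≡.cong₂ (λ a b → ħ ^ a * t ^ b * S F 𝐤) (ℕ.n∸n≡0 (wt 𝐤)) (ℕ.n∸n≡0 (dep 𝐤)) ⟩
    1# * 1# * S F 𝐤
      ≈⟨ solve 1 (λ s → con (+ 1) :* con (+ 1) :* s := s) refl _ ⟩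
    S F 𝐤 ∎
    where
    𝐤 : List ℕ
    𝐤 = k ∷ ks

  interpolated-hoffman : ∀ F G → G ≈⁺ S F →
    (∀ k ks → 2 ≤ k → All (1 ≤_) ks → D split F (k ∷ ks) ≈ D raise F (k ∷ ks)) →
    ∀ k ks → 2 ≤ k → All (1 ≤_) ks → splitSum G k ks ≈ rhsSum G k ks
  interpolated-hoffman F G G≈SF split≈raise k ks 2≤k 1≤ks = begin
    splitSum G k ks      ≈⟨ splitSum≈D G k ks ⟩
    D split G 𝐤          ≈⟨ D-cong split-linear G (S F) G≈SF 𝐤 1≤𝐤 ⟩
    D split (S F) 𝐤      ≈⟨ ∙-cancelʳ (S (D split F) 𝐤) _ _ commuted ⟩
    D rhs (S F) 𝐤        ≈⟨ D-cong rhs-linear G (S F) G≈SF 𝐤 1≤𝐤 ⟨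
    D rhs G 𝐤            ≈⟨ rhsSum≈D G k ks ⟨
    rhsSum G k ks        ∎
    where
    open GroupProperties +-group using (∙-cancelʳ)
    𝐤 : List ℕ
    𝐤 = k ∷ ks
    1≤k : 1 ≤ k
    1≤k = ℕ.<⇒≤ 2≤k
    1≤𝐤 : All (1 ≤_) 𝐤
    1≤𝐤 = 1≤k ∷ 1≤ks
    commuted : D split (S F) 𝐤 + S (D split F) 𝐤 ≈ D rhs (S F) 𝐤 + S (D split F) 𝐤
    commuted = trans
      -- All fillings inherit a first entry of at least 2, so the relation at t = 0 applies to each
      -- of them.
      (+-congˡ (S′-cong 2 (s≤s z≤n) split≈raise k ks 2≤k 1≤ks))
      (commutator F k ks 1≤k 1≤ks)

-- Specialisation to q-series with rational coefficients.

open import Defs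

ℚR ℚ⟦q⟧R ℚ⟦q⟧[t]R : CommutativeRing 0ℓ 0ℓ
ℚR = ℚ.+-*-commutativeRing
ℚ⟦q⟧R = SeriesRing.commutativeRing ℚR
ℚ⟦q⟧[t]R = PolynomialRing.commutativeRing ℚ⟦q⟧R

module TruncatedZeta where
  open RawRing ℚ⟦q⟧ using () renaming (Carrier to Series; _≈_ to _≈ₛ_; _+_ to _+ₛ_; _*_ to _*ₛ_; 1# to 1ₛ)
  open CommutativeRing ℚ⟦q⟧R using () renaming (refl to reflₛ; *-congˡ to *ₛ-congˡ)
  open RingNotation ℚ⟦q⟧ using () renaming (_^_ to _^ₛ_)
  open PowerSeries ℚ.+-*-rawRing using (inv; _/_)
  open FiniteSums ℚ⟦q⟧R
  open IndexOperators ℚ⟦q⟧R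
  open SeriesOrder ℚR

  v : Series
  v = inv 1-q

  u : ℕ → Series
  u i = inv [ suc i ]

  w : ℕ → ℕ → Series
  w k i = q ^ₛ ((k ∸ 1) ℕ.* suc i) / [ suc i ] ^ₛ k

  v-inverse : 1-q *ₛ v ≈ₛ 1ₛ
  v-inverse = *-inv 1-q 1-q-constant

  u-inverse : ∀ i → [ suc i ] *ₛ u i ≈ₛ 1ₛ
  u-inverse i = *-inv [ suc i ] ([]-constant i)

  open QIntegers.Inverses ℚ⟦q⟧R q v u v-inverse u-inverse
  open TruncatedHoffman ℚ⟦q⟧R u x w

  w-pow : ∀ κ i → w (suc κ) i ≈ₛ x i ^ₛ κ *ₛ u i
  w-pow κ i = power-quotient κ i (inv ([ suc i ] ^ₛ suc κ))
    (*-inv ([ suc i ] ^ₛ suc κ) (^-constant [ suc i ] (suc κ) ([]-constant i)))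

  ζq≤≈Z : ∀ M ks → ζq≤ M ks ≈ₛ Z M ks
  ζq≤≈Z M []       = reflₛ
  ζq≤≈Z M (k ∷ ks) = ∑<-cong M {λ i → w k i *ₛ ζq≤ i ks} {λ i → w k i *ₛ Z i ks}
    λ i _ → *ₛ-congˡ {w k i} (ζq≤≈Z i ks)

  hoffman-with-error : ∀ M ks → All (1 ≤_) ks → D split (Z M) ks +ₛ E M ks ≈ₛ D raise (Z M) ks
  hoffman-with-error = truncated-hoffman u-x x*u u*u w-pow

  order-x : ∀ i → Order≥ (suc i) (x i)
  order-x i = order-*ˡ (q ^ₛ suc i) (u i) (order-X^ (suc i))

  order-w : ∀ k i → 2 ≤ k → Order≥ (suc i) (w k i)
  order-w (suc (suc κ)) i (s≤s (s≤s _)) =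
    order-weaken (w (suc (suc κ)) i) (ℕ.m≤m+n (suc i) (κ ℕ.* suc i))
      (order-*ˡ (q ^ₛ (suc κ ℕ.* suc i)) (inv ([ suc i ] ^ₛ suc (suc κ)))
        (order-X^ (suc κ ℕ.* suc i)))

  -- With m = i + 1, the factor `w k i` is divisible by q^((k-1)m), hence by q^m as k ≥ 2, and each
  -- term of `top M i` by q^(M-m+1).
  order-E : ∀ M k ks → 2 ≤ k → Order≥ (suc M) (E M (k ∷ ks))
  order-E M k ks 2≤k = order-∑ M (λ i → w k i *ₛ Z i ks *ₛ top M i) λ i i<M →
    order-weaken (w k i *ₛ Z i ks *ₛ top M i) (ℕ.≤-reflexive (degree i i<M))
      (order-* (w k i *ₛ Z i ks) (top M i)
        (order-*ˡ (w k i) (Z i ks) (order-w k i 2≤k))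
        (order-∑ (suc i) (λ e → x (M ∸ suc i ℕ.+ e)) λ e _ →
          order-weaken (x (M ∸ suc i ℕ.+ e)) (s≤s (ℕ.m≤m+n (M ∸ suc i) e))
            (order-x (M ∸ suc i ℕ.+ e))))
    where
    degree : ∀ i → i < M → suc M ≡ suc i ℕ.+ suc (M ∸ suc i)
    degree i i<M = ≡.sym (≡.trans (ℕ.+-suc (suc i) (M ∸ suc i)) (≡.cong suc (ℕ.m+[n∸m]≡n i<M)))

  -- The cut-off inside `ζq` moves with the degree, so ζq agrees with the single truncation `Z n`
  -- only in the coefficient of q^n. Hence the coefficient is extracted first, under `D`, and the
  -- error of order n + 1 vanishes there.
  hoffman : ∀ k ks → 2 ≤ k → All (1 ≤_) ks → D split ζq (k ∷ ks) ≈ₛ D raise ζq (k ∷ ks)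
  hoffman k ks 2≤k 1≤ks n = begin
    D split ζq 𝐤 n                           ≡⟨ Coeff.D-split ≡.refl (λ _ _ → ≡.refl) ζq 𝐤 ⟩
    ℚI.D ℚI.split ζqₙ 𝐤                     ≡⟨ ℚI.D-cong ℚI.split-linear ζqₙ Zₙ ζq≡Z 𝐤 1≤𝐤 ⟩
    ℚI.D ℚI.split Zₙ 𝐤                      ≡⟨ Coeff.D-split ≡.refl (λ _ _ → ≡.refl) (Z n) 𝐤 ⟨
    D split (Z n) 𝐤 n                        ≡⟨ ℚ.+-identityʳ _ ⟨
    D split (Z n) 𝐤 n ℚ.+ ℚ.0ℚ               ≡⟨ ≡.cong (D split (Z n) 𝐤 n ℚ.+_) (order-E n k ks 2≤k n (ℕ.n<1+n n)) ⟨
    D split (Z n) 𝐤 n ℚ.+ E n 𝐤 n            ≡⟨ hoffman-with-error n 𝐤 1≤𝐤 n ⟩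
    D raise (Z n) 𝐤 n                        ≡⟨ Coeff.D-raise ≡.refl (λ _ _ → ≡.refl) (Z n) 𝐤 ⟩
    ℚI.D ℚI.raise Zₙ 𝐤                      ≡⟨ ℚI.D-cong ℚI.raise-linear ζqₙ Zₙ ζq≡Z 𝐤 1≤𝐤 ⟨
    ℚI.D ℚI.raise ζqₙ 𝐤                     ≡⟨ Coeff.D-raise ≡.refl (λ _ _ → ≡.refl) ζq 𝐤 ⟨
    D raise ζq 𝐤 n                           ∎
    where
    open ≡.≡-Reasoning
    module ℚI = IndexOperators ℚR
    module Coeff = AdditiveMap ℚ⟦q⟧R ℚR (λ f → f n)
    ζqₙ Zₙ : List ℕ → ℚ.ℚ
    ζqₙ 𝐩 = ζq 𝐩 n
    Zₙ 𝐩 = Z n 𝐩 n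
    𝐤 : List ℕ
    𝐤 = k ∷ ks
    1≤𝐤 : All (1 ≤_) 𝐤
    1≤𝐤 = ℕ.<⇒≤ 2≤k ∷ 1≤ks
    ζq≡Z : ∀ k ks → All (1 ≤_) (k ∷ ks) → ζq (k ∷ ks) n ≡ Z n (k ∷ ks) n
    ζq≡Z k ks _ = ζq≤≈Z n (k ∷ ks) n

Cζq : List ℕ → Polynomial.Poly ℚ⟦q⟧
Cζq 𝐩 = C (ζq 𝐩)

C-hoffman : let open IndexOperators ℚ⟦q⟧[t]R in
  ∀ k ks → 2 ≤ k → All (1 ≤_) ks → D split Cζq (k ∷ ks) ≈ D raise Cζq (k ∷ ks)
C-hoffman k ks 2≤k 1≤ks = begin
  D split Cζq 𝐤                   ≈⟨ D-split C-0 C-+ ζq 𝐤 ⟨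
  C (Series.D Series.split ζq 𝐤)  ≈⟨ C-cong (TruncatedZeta.hoffman k ks 2≤k 1≤ks) ⟩
  C (Series.D Series.raise ζq 𝐤)  ≈⟨ D-raise C-0 C-+ ζq 𝐤 ⟩
  D raise Cζq 𝐤                   ∎
  where
  open IndexOperators ℚ⟦q⟧[t]R
  open SetoidReasoning (CommutativeRing.setoid ℚ⟦q⟧[t]R)
  open AdditiveMap ℚ⟦q⟧R ℚ⟦q⟧[t]R C
  open CommutativeRing ℚ⟦q⟧R using () renaming (refl to reflₛ)
  module Series where
    open IndexOperators ℚ⟦q⟧R public
    open RawRing ℚ⟦q⟧ public
  𝐤 : List ℕ
  𝐤 = k ∷ ks
  C-0 : C Series.0# ≈ 0#
  C-0 zero    = reflₛ
  C-0 (suc n) = reflₛ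
  C-+ : ∀ f g → C (f Series.+ g) ≈ C f + C g
  C-+ f g n = reflₛ
  C-cong : ∀ {f g} → f Series.≈ g → C f ≈ C g
  C-cong f≈g zero    = f≈g
  C-cong f≈g (suc n) = reflₛ

theorem4p1 :
  ∀ (k₁ : ℕ) (ks : List ℕ) → 2 ≤ k₁ → All (1 ≤_) ks →
  let 𝐤 = k₁ ∷ ks
      l = length 𝐤
      k = lookup 𝐤
  in
  (∑[ i < l ] ∑[ j < k i ∸ 1 ]
      ζqᵗ (take (toℕ i) 𝐤 ++ (k i ∸ toℕ j) ∷ (toℕ j ℕ.+ 1) ∷ drop (suc (toℕ i)) 𝐤))
  ≈
  (∑[ i < l ]
      (1# + (k i × 1# - 2 × 1# + δ (suc (toℕ i)) l × 1#) * t)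
        * ζqᵗ (take (toℕ i) 𝐤 ++ (k i ℕ.+ 1) ∷ drop (suc (toℕ i)) 𝐤))
  + t * (t - 1#)
      * (∑[ i < l ∸ 1 ]
          ζqᵗ (take (toℕ i) 𝐤 ++ (k (inject₁ i) ℕ.+ k (suc i) ℕ.+ 1) ∷ drop (2 ℕ.+ toℕ i) 𝐤))
  + C 1-q
      * ( (∑[ i < l ] t * (k i × 1# - 1#) * ζqᵗ 𝐤)
        + t * (t - 1#)
            * (∑[ i < l ∸ 1 ]
                ζqᵗ (take (toℕ i) 𝐤 ++ (k (inject₁ i) ℕ.+ k (suc i)) ∷ drop (2 ℕ.+ toℕ i) 𝐤)))
theorem4p1 = interpolated-hoffman Cζq ζqᵗ (weighted-fillings Cζq) C-hoffman
  where open Fillings ℚ⟦q⟧[t]R t (C 1-q)
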